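{- There is an absolute constant $C>0$ such that for every $\epsilon\in(0,1)$, every submodular hypergraph $H=(V,E,\{g_e\})$ with $n=|V|$ all of whose splitting functions are monotone admits a $(1+\epsilon)$-sparsifier of size at most $C\epsilon^{ -2}n^2$ which is a reweighted subgraph of $H$.
   Context: A submodular hypergraph $H=(V,E,\{g_e\})$ has finite vertex set $V$, hyperedges $e\subseteq V$, and submodular splitting functions $g_e:2^e\to\mathbb{R}_{\ge0}$ with $g_e(\emptyset)=0$; $\mathrm{cut}_H(S)=\sum_e g_e(S\cap e)$. $g_e$ is monotone if $g_e(S)\le g_e(T)$ whenever $S\subseteq T$. A $(1+\epsilon)$-sparsifier is $H'=(V,E',\{g'_e\})$ with $\mathrm{cut}_{H'}(S)\in[(1-\epsilon)\mathrm{cut}_H(S),(1+\epsilon)\mathrm{cut}_H(S)]$ for all $S\subseteq V$, of size $|E'|$; it is a reweighted subgraph if $E'\subseteq E$ and $g'_e=s_eg_e$ with $s_e>0$.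
   Formalization: The splitting functions g_e take rational rather than real values and ε is rational; the weights s_e and the constant C obtained are likewise rational. -}

module Defs where

open import Data.Nat using (ℕ; zero; suc)
open import Data.Integer using (+_)
open import Data.Fin using (Fin; zero; suc)
open import Data.Vec using (lookup)
open import Data.Bool using (Bool; true; false)
open import Data.Fin.Subset using (Subset; Side; inside; outside; _∩_; _∪_; _⊆_; _∈_; ⊥; ∣_∣)
open import Data.Rational using (ℚ; 0ℚ; 1ℚ; _+_; _*_; _-_; _≤_; _<_; _/_)
open import Data.Product using (_×_)
open import Function.Definitions using (Injective)
open import Relation.Binary.PropositionalEquality using (_≡_)

ℕ→ℚ : ℕ → ℚ
ℕ→ℚ k = + k / 1

Σℚ : ∀ {m} → (Fin m → ℚ) → ℚ
Σℚ {zero} f = 0ℚ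
Σℚ {suc m} f = f zero + Σℚ (λ i → f (suc i))

-- A splitting function g_e : 2^e → ℚ≥0 on hyperedge e ⊆ V, represented as a
-- function on subsets of V of which only the values on subsets of e matter.
IsSplittingFunction : ∀ {n} → Subset n → (Subset n → ℚ) → Set
IsSplittingFunction e g =
  (g ⊥ ≡ 0ℚ)
  × (∀ S → S ⊆ e → 0ℚ ≤ g S)
  × (∀ S T → S ⊆ e → T ⊆ e → g (S ∪ T) + g (S ∩ T) ≤ g S + g T)

IsMonotone : ∀ {n} → Subset n → (Subset n → ℚ) → Set
IsMonotone e g = ∀ S T → S ⊆ e → T ⊆ e → S ⊆ T → g S ≤ g T

record SubmodularHypergraph (n m : ℕ) : Set where
  field
    edge : Fin m → Subset n
    edge-distinct : Injective _≡_ _≡_ edge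
    g : Fin m → Subset n → ℚ
    g-splitting : ∀ i → IsSplittingFunction (edge i) (g i)

open SubmodularHypergraph public

AllMonotone : ∀ {n m} → SubmodularHypergraph n m → Set
AllMonotone H = ∀ i → IsMonotone (edge H i) (g H i)

cut : ∀ {n m} → SubmodularHypergraph n m → Subset n → ℚ
cut H S = Σℚ (λ i → g H i (S ∩ edge H i))

reweightedCut : ∀ {n m} → SubmodularHypergraph n m → Subset m → (Fin m → ℚ) → Subset n → ℚ
reweightedCut H E' s S = Σℚ term
  where
  term : _ → ℚ
  term i with lookup E' i
  ... | inside  = s i * g H i (S ∩ edge H i)
  ... | outside = 0ℚ

IsReweightedSparsifier : ∀ {n m} → SubmodularHypergraph n m → ℚ → Subset m → (Fin m → ℚ) → Set
IsReweightedSparsifier H ε E' s =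
  (∀ i → i ∈ E' → 0ℚ < s i)
  × (∀ S → ((1ℚ - ε) * cut H S ≤ reweightedCut H E' s S)
           × (reweightedCut H E' s S ≤ (1ℚ + ε) * cut H S))

{-# OPTIONS --safe #-}
module Submission where

-- For S ⊆ V write h_e(S) = g_e(S ∩ e).  Subadditivity and monotonicity give
-- h_e(S) ≤ Σ_{v ∈ S} h_e({v}) ≤ cut(S) · w_e, where w_e = Σ_v h_e({v}) / cut({v}) and Σ_e w_e = n.
-- Sampling N edges with probability w_e / n thus yields, for each S, variables
-- y = h_e(S) / (cut(S) w_e) in [0,1] with mean 1/n, and N of order n · n / ε² samples concentrate
-- for all 2^n sets at once.  The sampling is derandomised by keeping a potential, the sum over S and
-- over d = ± ε/8 of the products of (1 + d y) / (1 + d/n), below its initial value 2^(n+1).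
-- No exponentials are needed: AM-GM turns a bound on such a product into one on the sum of the y.

open import Defs
open import Data.Nat using (ℕ; zero; suc)
import Data.Nat as ℕ
import Data.Nat.Properties as ℕ
import Data.Integer as ℤ
import Data.Integer.Properties as ℤ
open import Data.Bool using (true; false)
open import Data.Fin using (Fin; zero; suc)
open import Data.Fin.Properties using (any?)
open import Data.Fin.Subset using (Subset; inside; outside; _∈_; _∉_; _⊆_; _∪_; _∩_; ⁅_⁆; ∣_∣; ⊥)
open import Data.Fin.Subset.Properties
open import Data.Vec using (Vec; []; _∷_; lookup; here; there)
open import Data.Vec.Properties using ([]=⇒lookup)
open import Data.Vec.Relation.Unary.All using (All; []; _∷_)
open import Data.Rational hiding (∣_∣)
open import Data.Rational.Properties
import Data.Rational.Unnormalised as ℚᵘ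
import Data.Rational.Unnormalised.Properties as ℚᵘ
open import Data.Rational.Solver using (module +-*-Solver)
open +-*-Solver using (solve; con; _:=_; _:+_; _:*_; _:-_; :-_)
open import Data.Product using (Σ; ∃; _×_; _,_; proj₁; proj₂)
open import Data.Sum using (inj₁; inj₂; [_,_]′)
open import Data.Empty using (⊥-elim)
open import Function using (_∘_)
open import Relation.Nullary using (yes; no; _×-dec_)
open import Relation.Nullary.Decidable using (toSum)
open import Relation.Binary.PropositionalEquality using (_≡_; _≢_; refl; sym; trans; cong; cong₂; subst; subst₂; module ≡-Reasoning)

-- Order and division in the rationals

2ℚ 3ℚ 4ℚ 8ℚ 16ℚ 17ℚ 51ℚ : ℚ
2ℚ = ℕ→ℚ 2
3ℚ = ℕ→ℚ 3
4ℚ = ℕ→ℚ 4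
8ℚ = ℕ→ℚ 8
16ℚ = ℕ→ℚ 16
17ℚ = ℕ→ℚ 17
51ℚ = ℕ→ℚ 51

≤-by : ∀ {a b} d → 0ℚ ≤ d → b ≡ a + d → a ≤ b
≤-by {a} {b} d 0≤d b≡a+d = subst (a ≤_) (sym b≡a+d) (subst (_≤ a + d) (+-identityʳ a) (+-monoʳ-≤ a 0≤d))

p≤q⇒0≤q-p : ∀ {p q} → p ≤ q → 0ℚ ≤ q - p
p≤q⇒0≤q-p {p} {q} p≤q = subst (_≤ q - p) (+-inverseʳ p) (+-monoˡ-≤ (- p) p≤q)

p<q⇒0<q-p : ∀ {p q} → p < q → 0ℚ < q - p
p<q⇒0<q-p {p} {q} p<q = subst (_< q - p) (+-inverseʳ p) (+-monoˡ-< (- p) p<q)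

*-monoˡ : ∀ {p q} r → 0ℚ ≤ r → p ≤ q → r * p ≤ r * q
*-monoˡ r 0≤r = *-monoˡ-≤-nonNeg r {{nonNegative 0≤r}}

*-monoʳ : ∀ {p q} r → 0ℚ ≤ r → p ≤ q → p * r ≤ q * r
*-monoʳ r 0≤r = *-monoʳ-≤-nonNeg r {{nonNegative 0≤r}}

*-mono : ∀ {p q r s} → 0ℚ ≤ p → 0ℚ ≤ s → p ≤ q → r ≤ s → p * r ≤ q * s
*-mono {p} {q} {r} {s} 0≤p 0≤s p≤q r≤s = ≤-trans (*-monoˡ p 0≤p r≤s) (*-monoʳ s 0≤s p≤q)

+-nonNeg : ∀ {p q} → 0ℚ ≤ p → 0ℚ ≤ q → 0ℚ ≤ p + q
+-nonNeg {p} {q} = +-mono-≤ {0ℚ} {p} {0ℚ} {q}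

*-nonNeg : ∀ {p q} → 0ℚ ≤ p → 0ℚ ≤ q → 0ℚ ≤ p * q
*-nonNeg {p} {q} 0≤p 0≤q = subst (_≤ p * q) (*-zeroʳ p) (*-monoˡ p 0≤p 0≤q)

*-pos : ∀ {p q} → 0ℚ < p → 0ℚ < q → 0ℚ < p * q
*-pos {p} {q} 0<p 0<q = positive⁻¹ (p * q) {{pos*pos⇒pos p {{positive 0<p}} q {{positive 0<q}}}}

square-nonNeg : ∀ p → 0ℚ ≤ p * p
square-nonNeg p with ≤-total 0ℚ p
... | inj₁ 0≤p = *-nonNeg 0≤p 0≤p
... | inj₂ p≤0 = subst (0ℚ ≤_) (solve 1 (λ x → (:- x) :* (:- x) := x :* x) refl p) (*-nonNeg 0≤-p 0≤-p)
  where
  0≤-p : 0ℚ ≤ - p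
  0≤-p = neg-antimono-≤ p≤0

≢0⇒pos : ∀ {p} → 0ℚ ≤ p → p ≢ 0ℚ → 0ℚ < p
≢0⇒pos 0≤p p≢0 = ≰⇒> (λ p≤0 → p≢0 (≤-antisym p≤0 0≤p))

+-zeroˡ : ∀ {p} → p ≡ 0ℚ → ∀ q → p + q ≡ q
+-zeroˡ refl = +-identityˡ

*-annihˡ : ∀ {p} → p ≡ 0ℚ → ∀ q → p * q ≡ 0ℚ
*-annihˡ refl = *-zeroˡ

-- Totalised with value 0 at 0, so that quotients by weights that may vanish can be written without
-- a side condition.
inv : ℚ → ℚ
inv p with p ≟ 0ℚ
... | yes _   = 0ℚ
... | no p≢0 = 1/_ p {{≢-nonZero p≢0}}

*-inv : ∀ {p} → p ≢ 0ℚ → p * inv p ≡ 1ℚ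
*-inv {p} p≢0 with p ≟ 0ℚ
... | yes p≡0 = ⊥-elim (p≢0 p≡0)
... | no  p≢0 = *-inverseʳ p {{≢-nonZero p≢0}}

inv-pos : ∀ {p} → 0ℚ < p → 0ℚ < inv p
inv-pos {p} 0<p with p ≟ 0ℚ
... | yes p≡0 = ⊥-elim (<-irrefl (sym p≡0) 0<p)
... | no  _   = positive⁻¹ _ {{1/pos⇒pos p {{positive 0<p}}}}

inv-nonNeg : ∀ {p} → 0ℚ ≤ p → 0ℚ ≤ inv p
inv-nonNeg {p} 0≤p with p ≟ 0ℚ
... | yes _   = ≤-refl
... | no  p≢0 = <⇒≤ (positive⁻¹ _ {{1/pos⇒pos p {{positive (≢0⇒pos 0≤p p≢0)}}}})

p*inv≤1 : ∀ p → p * inv p ≤ 1ℚ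
p*inv≤1 p = [ (λ p≡0 → ≤-trans (≤-reflexive (*-annihˡ p≡0 (inv p))) (nonNegative⁻¹ 1ℚ)) , (λ p≢0 → ≤-reflexive (*-inv p≢0)) ]′
  (toSum (p ≟ 0ℚ))

-- Division undone even at `p ≡ 0ℚ`: there the two bounds squeeze `q` to 0, which agrees with the
-- default value of `inv`.
p*[q*inv]≡q : ∀ {p q} → 0ℚ ≤ q → q ≤ p → p * (q * inv p) ≡ q
p*[q*inv]≡q {p} {q} 0≤q q≤p = [ zero-case , nonzero-case ]′ (toSum (p ≟ 0ℚ))
  where
  zero-case : p ≡ 0ℚ → p * (q * inv p) ≡ q
  zero-case p≡0 = trans (*-annihˡ p≡0 (q * inv p)) (≤-antisym 0≤q (≤-trans q≤p (≤-reflexive p≡0)))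
  nonzero-case : p ≢ 0ℚ → p * (q * inv p) ≡ q
  nonzero-case p≢0 = trans (solve 3 (λ p q i → p :* (q :* i) := q :* (p :* i)) refl p q (inv p))
    (trans (cong (q *_) (*-inv p≢0)) (*-identityʳ q))

-- Naturals as rationals, and rounding up

-- Since `_/_` normalises by a gcd, the comparison is made among unnormalised rationals, where the
-- denominators are literally 1.
ℕ→ℚ-+ : ∀ a b → ℕ→ℚ (a ℕ.+ b) ≡ ℕ→ℚ a + ℕ→ℚ b
ℕ→ℚ-+ a b = toℚᵘ-injective (ℚᵘ.≃-trans (toℚᵘ-homo-/1 (a ℕ.+ b))
  (ℚᵘ.≃-trans (ℚᵘ.*≡* (cong (λ z → z ℤ.* ℤ.+ 1) (cong₂ ℤ._+_ (sym (ℤ.*-identityʳ (ℤ.+ a))) (sym (ℤ.*-identityʳ (ℤ.+ b))))))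
  (ℚᵘ.≃-trans (ℚᵘ.≃-sym (ℚᵘ.+-cong (toℚᵘ-homo-/1 a) (toℚᵘ-homo-/1 b))) (ℚᵘ.≃-sym (toℚᵘ-homo-+ (ℕ→ℚ a) (ℕ→ℚ b))))))
  where
  toℚᵘ-homo-/1 : ∀ k → toℚᵘ (ℕ→ℚ k) ℚᵘ.≃ ℚᵘ.mkℚᵘ (ℤ.+ k) 0
  toℚᵘ-homo-/1 k = toℚᵘ-fromℚᵘ (ℚᵘ.mkℚᵘ (ℤ.+ k) 0)

ℕ→ℚ-suc : ∀ k → ℕ→ℚ (suc k) ≡ 1ℚ + ℕ→ℚ k
ℕ→ℚ-suc = ℕ→ℚ-+ 1

ℕ→ℚ-nonNeg : ∀ k → 0ℚ ≤ ℕ→ℚ k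
ℕ→ℚ-nonNeg zero    = ≤-refl
ℕ→ℚ-nonNeg (suc k) = subst (0ℚ ≤_) (sym (ℕ→ℚ-suc k)) (+-nonNeg {1ℚ} {ℕ→ℚ k} (nonNegative⁻¹ 1ℚ) (ℕ→ℚ-nonNeg k))

ℕ→ℚ-* : ∀ a b → ℕ→ℚ (a ℕ.* b) ≡ ℕ→ℚ a * ℕ→ℚ b
ℕ→ℚ-* zero    b = sym (*-zeroˡ (ℕ→ℚ b))
ℕ→ℚ-* (suc a) b = begin
  ℕ→ℚ (b ℕ.+ a ℕ.* b)         ≡⟨ ℕ→ℚ-+ b (a ℕ.* b) ⟩
  ℕ→ℚ b + ℕ→ℚ (a ℕ.* b)      ≡⟨ cong (ℕ→ℚ b +_) (ℕ→ℚ-* a b) ⟩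
  ℕ→ℚ b + ℕ→ℚ a * ℕ→ℚ b     ≡⟨ solve 2 (λ x y → y :+ x :* y := (con 1ℚ :+ x) :* y) refl (ℕ→ℚ a) (ℕ→ℚ b) ⟩
  (1ℚ + ℕ→ℚ a) * ℕ→ℚ b       ≡⟨ cong (_* ℕ→ℚ b) (ℕ→ℚ-suc a) ⟨
  ℕ→ℚ (suc a) * ℕ→ℚ b        ∎
  where open ≡-Reasoning

ℕ→ℚ-mono : ∀ {a b} → a ℕ.≤ b → ℕ→ℚ a ≤ ℕ→ℚ b
ℕ→ℚ-mono {b = b} ℕ.z≤n = ℕ→ℚ-nonNeg b
ℕ→ℚ-mono {suc a} {suc b} (ℕ.s≤s a≤b) = subst₂ _≤_ (sym (ℕ→ℚ-suc a)) (sym (ℕ→ℚ-suc b)) (+-monoʳ-≤ 1ℚ (ℕ→ℚ-mono a≤b))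

-- The numerator is large enough, the denominator being at least 1; a negative rational lies below
-- 0.
archimedean : ∀ p → ∃ λ k → p ≤ ℕ→ℚ k
archimedean p@(mkℚ (ℤ.+ k) d-1 _) = k , toℚᵘ-cancel-≤ (ℚᵘ.≤-trans {j = ℚᵘ.mkℚᵘ (ℤ.+ k) 0}
  (ℚᵘ.*≤* (ℤ.*-monoˡ-≤-nonNeg (ℤ.+ k) (ℤ.+≤+ (ℕ.s≤s ℕ.z≤n))))
  (ℚᵘ.≤-reflexive (ℚᵘ.≃-sym (toℚᵘ-fromℚᵘ (ℚᵘ.mkℚᵘ (ℤ.+ k) 0)))))
archimedean (mkℚ ℤ.-[1+ _ ] _ _) = 0 , *≤* ℤ.-≤+

-- Descends from the Archimedean bound until the next smaller natural would fall below `p`; that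
-- failure is what gives the upper estimate `p + 1ℚ`.
roundUp : ∀ p → 0ℚ ≤ p → ∃ λ k → p ≤ ℕ→ℚ k × ℕ→ℚ k ≤ p + 1ℚ
roundUp p 0≤p = descend (proj₁ (archimedean p)) (proj₂ (archimedean p))
  where
  descend : ∀ k → p ≤ ℕ→ℚ k → ∃ λ k → p ≤ ℕ→ℚ k × ℕ→ℚ k ≤ p + 1ℚ
  descend zero    p≤k = 0 , p≤k , +-nonNeg {p} {1ℚ} 0≤p (nonNegative⁻¹ 1ℚ)
  descend (suc k) p≤1+k with p ≤? ℕ→ℚ k
  ... | yes p≤k = descend k p≤k
  ... | no  p≰k = suc k , p≤1+k ,
    subst₂ _≤_ (sym (ℕ→ℚ-suc k)) (+-comm 1ℚ p) (+-monoʳ-≤ 1ℚ (<⇒≤ (≰⇒> p≰k)))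

-- Powers, Bernoulli and the tangent inequality

infixr 8 _^_
_^_ : ℚ → ℕ → ℚ
p ^ zero  = 1ℚ
p ^ suc k = p * p ^ k

^-nonNeg : ∀ {p} k → 0ℚ ≤ p → 0ℚ ≤ p ^ k
^-nonNeg zero    0≤p = nonNegative⁻¹ 1ℚ
^-nonNeg (suc k) 0≤p = *-nonNeg 0≤p (^-nonNeg k 0≤p)

^-≤1 : ∀ {p} k → 0ℚ ≤ p → p ≤ 1ℚ → p ^ k ≤ 1ℚ
^-≤1 zero    0≤p p≤1 = ≤-refl
^-≤1 {p} (suc k) 0≤p p≤1 = *-mono {s = 1ℚ} 0≤p (nonNegative⁻¹ 1ℚ) p≤1 (^-≤1 k 0≤p p≤1)

^-distrib-* : ∀ p q k → (p * q) ^ k ≡ p ^ k * q ^ k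
^-distrib-* p q zero    = refl
^-distrib-* p q (suc k) = trans (cong (p * q *_) (^-distrib-* p q k))
  (solve 4 (λ p q P Q → p :* q :* (P :* Q) := p :* P :* (q :* Q)) refl p q (p ^ k) (q ^ k))

^-+ : ∀ p j k → p ^ (j ℕ.+ k) ≡ p ^ j * p ^ k
^-+ p zero    k = sym (*-identityˡ (p ^ k))
^-+ p (suc j) k = trans (cong (p *_) (^-+ p j k)) (sym (*-assoc p (p ^ j) (p ^ k)))

^-* : ∀ p j k → p ^ (j ℕ.* k) ≡ (p ^ k) ^ j
^-* p zero    k = refl
^-* p (suc j) k = trans (^-+ p k (j ℕ.* k)) (cong (p ^ k *_) (^-* p j k))

bernoulli : ∀ {x} k → 0ℚ ≤ x → 1ℚ + ℕ→ℚ k * x ≤ (1ℚ + x) ^ k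
bernoulli {x} zero    0≤x = ≤-reflexive (solve 1 (λ x → con 1ℚ :+ con 0ℚ :* x := con 1ℚ) refl x)
bernoulli {x} (suc k) 0≤x = ≤-trans
  (≤-by (ℕ→ℚ k * (x * x)) (*-nonNeg (ℕ→ℚ-nonNeg k) (square-nonNeg x))
    (trans (solve 2 (λ x k → (con 1ℚ :+ x) :* (con 1ℚ :+ k :* x) := con 1ℚ :+ (con 1ℚ :+ k) :* x :+ k :* (x :* x)) refl x (ℕ→ℚ k))
      (cong (λ K → 1ℚ + K * x + ℕ→ℚ k * (x * x)) (sym (ℕ→ℚ-suc k)))))
  (*-monoˡ (1ℚ + x) (+-nonNeg (nonNegative⁻¹ 1ℚ) 0≤x) (bernoulli k 0≤x))

-- Stands in for `(1 - x)^k ≤ exp (- k x)`: Bernoulli gives `2 ≤ (1 + x)^k`, and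
-- `(1 + x) (1 - x) ≤ 1`.
2*[1-x]^k≤1 : ∀ {x} k → 0ℚ ≤ x → x ≤ 1ℚ → 1ℚ ≤ ℕ→ℚ k * x → 2ℚ * (1ℚ - x) ^ k ≤ 1ℚ
2*[1-x]^k≤1 {x} k 0≤x x≤1 1≤kx = begin
  2ℚ * (1ℚ - x) ^ k
    ≤⟨ *-monoʳ ((1ℚ - x) ^ k) (^-nonNeg k 0≤1-x) (≤-trans (+-monoʳ-≤ 1ℚ 1≤kx) (bernoulli k 0≤x)) ⟩
  (1ℚ + x) ^ k * (1ℚ - x) ^ k     ≡⟨ ^-distrib-* (1ℚ + x) (1ℚ - x) k ⟨
  ((1ℚ + x) * (1ℚ - x)) ^ k       ≤⟨ ^-≤1 k (*-nonNeg (+-nonNeg (nonNegative⁻¹ 1ℚ) 0≤x) 0≤1-x)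
          (≤-by (x * x) (square-nonNeg x)
          (solve 1 (λ x → con 1ℚ := (con 1ℚ :+ x) :* (con 1ℚ :- x) :+ x :* x) refl x)) ⟩
  1ℚ                                ∎
  where
  open ≤-Reasoning
  0≤1-x : 0ℚ ≤ 1ℚ - x
  0≤1-x = p≤q⇒0≤q-p x≤1

-- The graph of `t ^ suc k` lies above its tangent at `a`, written without subtraction. In the
-- induction the difference of the two sides is `t` times the previous difference plus a nonnegative
-- multiple of `(t - a)` squared.
weighted-AM-GM : ∀ {t a} k → 0ℚ ≤ t → 0ℚ ≤ a → ℕ→ℚ (suc k) * (t * a ^ k) ≤ t ^ suc k + ℕ→ℚ k * a ^ suc k
weighted-AM-GM {t} {a} zero 0≤t 0≤a = ≤-reflexive
  (solve 2 (λ t a → con 1ℚ :* (t :* con 1ℚ) := t :* con 1ℚ :+ con 0ℚ :* (a :* con 1ℚ)) refl t a)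
weighted-AM-GM {t} {a} (suc k) 0≤t 0≤a = ≤-by
  (t * (T + K * (a * A) - K1 * (t * A)) + K1 * A * ((t - a) * (t - a)))
  (+-nonNeg (*-nonNeg 0≤t (p≤q⇒0≤q-p (weighted-AM-GM k 0≤t 0≤a)))
    (*-nonNeg (*-nonNeg (ℕ→ℚ-nonNeg (suc k)) (^-nonNeg k 0≤a)) (square-nonNeg (t - a))))
  eq
  where
  T = t ^ suc k
  A = a ^ k
  K = ℕ→ℚ k
  K1 = ℕ→ℚ (suc k)
  eq : t * T + K1 * (a * (a * A))
    ≡ ℕ→ℚ (suc (suc k)) * (t * (a * A)) + (t * (T + K * (a * A) - K1 * (t * A)) + K1 * A * ((t - a) * (t - a)))
  eq rewrite ℕ→ℚ-suc (suc k) | ℕ→ℚ-suc k = solve 5 (λ t a T A K →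
     t :* T :+ (con 1ℚ :+ K) :* (a :* (a :* A))
       := (con 1ℚ :+ (con 1ℚ :+ K)) :* (t :* (a :* A))
         :+ (t :* (T :+ K :* (a :* A) :- (con 1ℚ :+ K) :* (t :* A)) :+ (con 1ℚ :+ K) :* A :* ((t :- a) :* (t :- a))))
     refl t a T A K

-- Finite sums and products over indices, subsets and samples

Σℚ-cong : ∀ {m} {f h : Fin m → ℚ} → (∀ i → f i ≡ h i) → Σℚ f ≡ Σℚ h
Σℚ-cong {zero}  f≡h = refl
Σℚ-cong {suc m} f≡h = cong₂ _+_ (f≡h zero) (Σℚ-cong (λ i → f≡h (suc i)))

Σℚ-mono : ∀ {m} {f h : Fin m → ℚ} → (∀ i → f i ≤ h i) → Σℚ f ≤ Σℚ h
Σℚ-mono {zero}  f≤h = ≤-refl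
Σℚ-mono {suc m} f≤h = +-mono-≤ (f≤h zero) (Σℚ-mono (λ i → f≤h (suc i)))

Σℚ-nonNeg : ∀ {m} {f : Fin m → ℚ} → (∀ i → 0ℚ ≤ f i) → 0ℚ ≤ Σℚ f
Σℚ-nonNeg {zero}  0≤f = ≤-refl
Σℚ-nonNeg {suc m} 0≤f = +-nonNeg (0≤f zero) (Σℚ-nonNeg (λ i → 0≤f (suc i)))

term≤Σℚ : ∀ {m} {f : Fin m → ℚ} → (∀ i → 0ℚ ≤ f i) → ∀ i → f i ≤ Σℚ f
term≤Σℚ {f = f} 0≤f zero    = ≤-by _ (Σℚ-nonNeg (λ i → 0≤f (suc i))) refl
term≤Σℚ {f = f} 0≤f (suc i) = ≤-trans (term≤Σℚ (λ i → 0≤f (suc i)) i)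
  (≤-by (f zero) (0≤f zero) (+-comm (f zero) _))

Σℚ-+ : ∀ {m} (f h : Fin m → ℚ) → Σℚ (λ i → f i + h i) ≡ Σℚ f + Σℚ h
Σℚ-+ {zero}  f h = refl
Σℚ-+ {suc m} f h = trans (cong (f zero + h zero +_) (Σℚ-+ (λ i → f (suc i)) (λ i → h (suc i))))
  (solve 4 (λ a b A B → a :+ b :+ (A :+ B) := a :+ A :+ (b :+ B)) refl (f zero) (h zero) _ _)

Σℚ-*ˡ : ∀ {m} c (f : Fin m → ℚ) → Σℚ (λ i → c * f i) ≡ c * Σℚ f
Σℚ-*ˡ {zero}  c f = sym (*-zeroʳ c)
Σℚ-*ˡ {suc m} c f = trans (cong (c * f zero +_) (Σℚ-*ˡ c (λ i → f (suc i)))) (sym (*-distribˡ-+ c (f zero) _))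

Σℚ-*ʳ : ∀ {m} (f : Fin m → ℚ) c → Σℚ (λ i → f i * c) ≡ Σℚ f * c
Σℚ-*ʳ f c = trans (Σℚ-cong (λ i → *-comm (f i) c)) (trans (Σℚ-*ˡ c f) (*-comm c (Σℚ f)))

Σℚ-const : ∀ m c → Σℚ {m} (λ _ → c) ≡ ℕ→ℚ m * c
Σℚ-const zero    c = sym (*-zeroˡ c)
Σℚ-const (suc m) c = trans (cong (c +_) (Σℚ-const m c))
  (trans (solve 2 (λ c k → c :+ k :* c := (con 1ℚ :+ k) :* c) refl c (ℕ→ℚ m)) (cong (_* c) (sym (ℕ→ℚ-suc m))))

Σℚ-swap : ∀ {k m} (f : Fin k → Fin m → ℚ) → Σℚ (λ i → Σℚ (f i)) ≡ Σℚ (λ j → Σℚ (λ i → f i j))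
Σℚ-swap {zero}  {m} f = sym (trans (Σℚ-const m 0ℚ) (*-zeroʳ (ℕ→ℚ m)))
Σℚ-swap {suc k} f = trans (cong (Σℚ (f zero) +_) (Σℚ-swap (λ i → f (suc i))))
  (sym (Σℚ-+ (f zero) (λ j → Σℚ (λ i → f (suc i) j))))

ΣSub : ∀ {n} → (Subset n → ℚ) → ℚ
ΣSub {zero}  f = f []
ΣSub {suc n} f = ΣSub (λ S → f (true ∷ S)) + ΣSub (λ S → f (false ∷ S))

ΣSub-cong : ∀ {n} {f h : Subset n → ℚ} → (∀ S → f S ≡ h S) → ΣSub f ≡ ΣSub h
ΣSub-cong {zero}  f≡h = f≡h []
ΣSub-cong {suc n} f≡h = cong₂ _+_ (ΣSub-cong (λ S → f≡h (true ∷ S))) (ΣSub-cong (λ S → f≡h (false ∷ S)))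

ΣSub-nonNeg : ∀ {n} {f : Subset n → ℚ} → (∀ S → 0ℚ ≤ f S) → 0ℚ ≤ ΣSub f
ΣSub-nonNeg {zero}  0≤f = 0≤f []
ΣSub-nonNeg {suc n} 0≤f = +-nonNeg (ΣSub-nonNeg (λ S → 0≤f (true ∷ S))) (ΣSub-nonNeg (λ S → 0≤f (false ∷ S)))

term≤ΣSub : ∀ {n} {f : Subset n → ℚ} → (∀ S → 0ℚ ≤ f S) → ∀ S → f S ≤ ΣSub f
term≤ΣSub 0≤f []          = ≤-refl
term≤ΣSub 0≤f (true ∷ S)  = ≤-trans (term≤ΣSub (λ S → 0≤f (true ∷ S)) S)
  (≤-by _ (ΣSub-nonNeg (λ S → 0≤f (false ∷ S))) refl)
term≤ΣSub {f = f} 0≤f (false ∷ S) = ≤-trans (term≤ΣSub (λ S → 0≤f (false ∷ S)) S)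
  (≤-by _ (ΣSub-nonNeg (λ S → 0≤f (true ∷ S))) (+-comm (ΣSub (λ S → f (true ∷ S))) (ΣSub (λ S → f (false ∷ S)))))

ΣSub-*ˡ : ∀ {n} c (f : Subset n → ℚ) → ΣSub (λ S → c * f S) ≡ c * ΣSub f
ΣSub-*ˡ {zero}  c f = refl
ΣSub-*ˡ {suc n} c f = trans (cong₂ _+_ (ΣSub-*ˡ c (λ S → f (true ∷ S))) (ΣSub-*ˡ c (λ S → f (false ∷ S))))
  (sym (*-distribˡ-+ c _ _))

ΣSub-1 : ∀ n → ΣSub {n} (λ _ → 1ℚ) ≡ 2ℚ ^ n
ΣSub-1 zero    = refl
ΣSub-1 (suc n) = trans (cong₂ _+_ (ΣSub-1 n) (ΣSub-1 n)) (solve 1 (λ x → x :+ x := con 2ℚ :* x) refl (2ℚ ^ n))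

Σℚ-ΣSub-swap : ∀ {n m} (f : Fin m → Subset n → ℚ) → Σℚ (λ e → ΣSub (f e)) ≡ ΣSub (λ S → Σℚ (λ e → f e S))
Σℚ-ΣSub-swap {zero}  f = refl
Σℚ-ΣSub-swap {suc n} f = trans (Σℚ-+ (λ e → ΣSub (λ S → f e (true ∷ S))) (λ e → ΣSub (λ S → f e (false ∷ S))))
  (cong₂ _+_ (Σℚ-ΣSub-swap (λ e S → f e (true ∷ S))) (Σℚ-ΣSub-swap (λ e S → f e (false ∷ S))))

sumOver prodOver : ∀ {A : Set} {N} → (A → ℚ) → Vec A N → ℚ
sumOver f []       = 0ℚ
sumOver f (e ∷ L)  = f e + sumOver f L
prodOver f []      = 1ℚ
prodOver f (e ∷ L) = f e * prodOver f L

module _ {A : Set} where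

  sumOver-nonNeg : ∀ {f : A → ℚ} {N} (L : Vec A N) → (∀ e → 0ℚ ≤ f e) → 0ℚ ≤ sumOver f L
  sumOver-nonNeg []      0≤f = ≤-refl
  sumOver-nonNeg (e ∷ L) 0≤f = +-nonNeg (0≤f e) (sumOver-nonNeg L 0≤f)

  sumOver-cong : ∀ {f h : A → ℚ} {N} (L : Vec A N) → (∀ e → f e ≡ h e) → sumOver f L ≡ sumOver h L
  sumOver-cong []      f≡h = refl
  sumOver-cong (e ∷ L) f≡h = cong₂ _+_ (f≡h e) (sumOver-cong L f≡h)

  sumOver-affine : ∀ a b (f : A → ℚ) {N} (L : Vec A N) →
    sumOver (λ e → a + b * f e) L ≡ ℕ→ℚ N * a + b * sumOver f L
  sumOver-affine a b f [] = solve 2 (λ a b → con 0ℚ := con 0ℚ :* a :+ b :* con 0ℚ) refl a b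
  sumOver-affine a b f {suc N} (e ∷ L) = begin
    a + b * f e + sumOver (λ e → a + b * f e) L       ≡⟨ cong (a + b * f e +_) (sumOver-affine a b f L) ⟩
    a + b * f e + (ℕ→ℚ N * a + b * sumOver f L)
      ≡⟨ solve 5 (λ a b x k s → a :+ b :* x :+ (k :* a :+ b :* s)
          := (con 1ℚ :+ k) :* a :+ b :* (x :+ s)) refl a b (f e) (ℕ→ℚ N) (sumOver f L) ⟩
    (1ℚ + ℕ→ℚ N) * a + b * (f e + sumOver f L)
      ≡⟨ cong (λ k → k * a + b * (f e + sumOver f L)) (ℕ→ℚ-suc N) ⟨
    ℕ→ℚ (suc N) * a + b * (f e + sumOver f L)         ∎
    where open ≡-Reasoning

  prodOver-nonNeg : ∀ {f : A → ℚ} {N} (L : Vec A N) → (∀ e → 0ℚ ≤ f e) → 0ℚ ≤ prodOver f L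
  prodOver-nonNeg []      0≤f = nonNegative⁻¹ 1ℚ
  prodOver-nonNeg (e ∷ L) 0≤f = *-nonNeg (0≤f e) (prodOver-nonNeg L 0≤f)

  1≤prodOver*prodOver : ∀ {f h : A → ℚ} {N} (L : Vec A N) → (∀ e → 1ℚ ≤ f e * h e) →
    1ℚ ≤ prodOver f L * prodOver h L
  1≤prodOver*prodOver []      1≤fh = ≤-refl
  1≤prodOver*prodOver {f} {h} (e ∷ L) 1≤fh = begin
    1ℚ                                               ≤⟨ 1≤fh e ⟩
    f e * h e                                        ≡⟨ *-identityʳ (f e * h e) ⟨
    f e * h e * 1ℚ
      ≤⟨ *-monoˡ (f e * h e) (≤-trans (nonNegative⁻¹ 1ℚ) (1≤fh e)) (1≤prodOver*prodOver L 1≤fh) ⟩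
    f e * h e * (prodOver f L * prodOver h L)
      ≡⟨ solve 4 (λ a b c d → a :* b :* (c :* d) := a :* c :* (b :* d)) refl (f e) (h e) _ _ ⟩
    f e * prodOver f L * (h e * prodOver h L)        ∎
    where open ≤-Reasoning

  -- Phrased with an upper bound `t` on the mean, which avoids roots. The product over the tail is
  -- replaced by a power of the tail's mean `a`; the head is at most `(N + 1) t - N a`, and the
  -- tangent inequality at `a` finishes.
  AM-GM : ∀ {f : A → ℚ} {N} (L : Vec A N) {t} → (∀ e → 0ℚ ≤ f e) → 0ℚ ≤ t →
    sumOver f L ≤ ℕ→ℚ N * t → prodOver f L ≤ t ^ N
  AM-GM [] 0≤f 0≤t Σ≤Nt = ≤-refl
  -- A single entry is treated apart because the next case divides by the length of the tail.
  AM-GM {f} {suc zero} (e ∷ []) {t} 0≤f 0≤t Σ≤Nt =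
    subst₂ _≤_ (solve 1 (λ x → x :+ con 0ℚ := x :* con 1ℚ) refl (f e)) (*-comm 1ℚ t) Σ≤Nt
  AM-GM {f} {suc N@(suc _)} (e ∷ L) {t} 0≤f 0≤t Σ≤Nt = begin
    f e * prodOver f L
      ≤⟨ *-monoˡ (f e) (0≤f e) (AM-GM L 0≤f 0≤a (≤-reflexive (sym N*a≡Σ))) ⟩
    f e * a ^ N                            ≤⟨ *-monoʳ (a ^ N) (^-nonNeg N 0≤a) fe≤ ⟩
    (ℕ→ℚ (suc N) * t - ℕ→ℚ N * a) * a ^ N ≤⟨ ≤-by _ (p≤q⇒0≤q-p (weighted-AM-GM N 0≤t 0≤a))
          (solve 6 (λ M t n a A T → T := (M :* t :- n :* a) :* A :+ (T :+ n :* (a :* A) :- M :* (t :* A)))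
          refl (ℕ→ℚ (suc N)) t (ℕ→ℚ N) a (a ^ N) (t ^ suc N)) ⟩
    t ^ suc N                              ∎
    where
    open ≤-Reasoning
    a = sumOver f L * inv (ℕ→ℚ N)
    0≤a : 0ℚ ≤ a
    0≤a = *-nonNeg (sumOver-nonNeg L 0≤f) (inv-nonNeg (ℕ→ℚ-nonNeg N))
    N≢0 : ℕ→ℚ N ≢ 0ℚ
    N≢0 N≡0 = <-irrefl (sym N≡0) (<-≤-trans (positive⁻¹ 1ℚ) (ℕ→ℚ-mono {1} {N} (ℕ.s≤s ℕ.z≤n)))
    N*a≡Σ : ℕ→ℚ N * a ≡ sumOver f L
    N*a≡Σ = trans (solve 3 (λ n s i → n :* (s :* i) := s :* (n :* i)) refl (ℕ→ℚ N) (sumOver f L) (inv (ℕ→ℚ N)))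
      (trans (cong (sumOver f L *_) (*-inv N≢0)) (*-identityʳ _))
    fe≤ : f e ≤ ℕ→ℚ (suc N) * t - ℕ→ℚ N * a
    fe≤ = ≤-by _ (p≤q⇒0≤q-p Σ≤Nt) (trans (cong (λ z → ℕ→ℚ (suc N) * t - z) N*a≡Σ)
      (solve 3 (λ T s x → T :- s := x :+ (T :- (x :+ s))) refl (ℕ→ℚ (suc N) * t) (sumOver f L) (f e)))

-- Derandomised selection by averaging

-- `ψ` may have any sign where `w` vanishes, since such terms contribute nothing; some weight is
-- positive and makes the sum strict.
Σℚ-weighted-pos : ∀ {m} {w ψ : Fin m → ℚ} → (∀ e → 0ℚ ≤ w e) → (∀ e → 0ℚ < w e → 0ℚ < ψ e) →
  0ℚ < Σℚ w → 0ℚ < Σℚ (λ e → w e * ψ e)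
Σℚ-weighted-pos {zero} 0≤w ψ>0 0<Σ = 0<Σ
Σℚ-weighted-pos {suc m} {w} {ψ} 0≤w ψ>0 0<Σ with w zero ≟ 0ℚ
... | yes w≡0 = subst (0ℚ <_) eq (Σℚ-weighted-pos (λ e → 0≤w (suc e)) (λ e → ψ>0 (suc e))
    (subst (0ℚ <_) (+-zeroˡ w≡0 (Σℚ (λ e → w (suc e)))) 0<Σ))
  where
  eq : Σℚ (λ e → w (suc e) * ψ (suc e)) ≡ w zero * ψ zero + Σℚ (λ e → w (suc e) * ψ (suc e))
  eq = sym (+-zeroˡ (*-annihˡ w≡0 (ψ zero)) (Σℚ (λ e → w (suc e) * ψ (suc e))))
... | no w≢0 = +-mono-<-≤ {0ℚ} {_} {0ℚ} (*-pos w>0 (ψ>0 zero w>0)) (Σℚ-nonNeg terms)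
  where
  w>0 = ≢0⇒pos (0≤w zero) w≢0
  terms : ∀ e → 0ℚ ≤ w (suc e) * ψ (suc e)
  terms e with w (suc e) ≟ 0ℚ
  ... | yes w≡0 = ≤-reflexive (sym (*-annihˡ w≡0 (ψ (suc e))))
  ... | no  w≢0 = <⇒≤ (*-pos we>0 (ψ>0 (suc e) we>0))
    where we>0 = ≢0⇒pos (0≤w (suc e)) w≢0

-- Otherwise `φ e - a` would be positive wherever `w e` is, although its weighted sum is 0. The
-- positive weight of the chosen index is recorded because the final edge weights divide by it.
below-average : ∀ {m} {w φ : Fin m → ℚ} {a} → (∀ e → 0ℚ ≤ w e) → 0ℚ < Σℚ w →
  Σℚ (λ e → w e * φ e) ≡ Σℚ w * a → ∃ λ e → 0ℚ < w e × φ e ≤ a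
below-average {w = w} {φ} {a} 0≤w 0<Σ avg with any? (λ e → (0ℚ <? w e) ×-dec (φ e ≤? a))
... | yes found = found
... | no  none  = ⊥-elim (<-irrefl (sym eq) (Σℚ-weighted-pos 0≤w
    (λ e w>0 → p<q⇒0<q-p (≰⇒> (λ φ≤a → none (e , w>0 , φ≤a)))) 0<Σ))
  where
  eq : Σℚ (λ e → w e * (φ e - a)) ≡ 0ℚ
  eq = begin
    Σℚ (λ e → w e * (φ e - a))
      ≡⟨ Σℚ-cong (λ e → solve 3 (λ w p a → w :* (p :- a) := w :* p :+ w :* (:- a)) refl (w e) (φ e) a) ⟩
    Σℚ (λ e → w e * φ e + w e * (- a))             ≡⟨ Σℚ-+ (λ e → w e * φ e) (λ e → w e * (- a)) ⟩
    Σℚ (λ e → w e * φ e) + Σℚ (λ e → w e * (- a)) ≡⟨ cong₂ _+_ avg (Σℚ-*ʳ w (- a)) ⟩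
    Σℚ w * a + Σℚ w * (- a)
      ≡⟨ solve 2 (λ s a → s :* a :+ s :* (:- a) := con 0ℚ) refl (Σℚ w) a ⟩
    0ℚ                                              ∎
    where open ≡-Reasoning

-- Method of conditional expectations. The empty sample has potential `2ℚ ^ n`, one unit per set.
-- The `w`-average of the potential after one more draw equals the present potential, so some draw
-- does not raise it. All terms being nonnegative, each product is bounded by the whole potential.
select : ∀ {n m} (w : Fin m → ℚ) (f : Subset n → Fin m → ℚ) → (∀ e → 0ℚ ≤ w e) → 0ℚ < Σℚ w →
  (∀ S e → 0ℚ ≤ f S e) → (∀ S → Σℚ (λ e → w e * f S e) ≡ Σℚ w) →
  ∀ N → Σ (Vec (Fin m) N) λ L → All (λ e → 0ℚ < w e) L × (∀ S → prodOver (f S) L ≤ 2ℚ ^ n)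
select {n} {m} w f 0≤w 0<Σ 0≤f avg N with go N
  where
  potential : ∀ {N} → Vec (Fin m) N → ℚ
  potential L = ΣSub (λ S → prodOver (f S) L)

  average : ∀ {N} (L : Vec (Fin m) N) → Σℚ (λ e → w e * potential (e ∷ L)) ≡ Σℚ w * potential L
  average L = begin
    Σℚ (λ e → w e * ΣSub (λ S → f S e * P S))     ≡⟨ Σℚ-cong (λ e → sym (ΣSub-*ˡ (w e) (λ S → f S e * P S))) ⟩
    Σℚ (λ e → ΣSub (λ S → w e * (f S e * P S)))   ≡⟨ Σℚ-ΣSub-swap (λ e S → w e * (f S e * P S)) ⟩
    ΣSub (λ S → Σℚ (λ e → w e * (f S e * P S)))
      ≡⟨ ΣSub-cong (λ S → trans (Σℚ-cong (λ e → sym (*-assoc (w e) (f S e) (P S))))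
          (trans (Σℚ-*ʳ (λ e → w e * f S e) (P S)) (cong (_* P S) (avg S)))) ⟩
    ΣSub (λ S → Σℚ w * P S)                        ≡⟨ ΣSub-*ˡ (Σℚ w) P ⟩
    Σℚ w * ΣSub P                                   ∎
    where
    open ≡-Reasoning
    P : Subset n → ℚ
    P S = prodOver (f S) L

  go : ∀ N → Σ (Vec (Fin m) N) λ L → All (λ e → 0ℚ < w e) L × potential L ≤ 2ℚ ^ n
  go zero = [] , [] , ≤-reflexive (ΣSub-1 n)
  go (suc N) with go N
  ... | L , w>0 , bound with below-average 0≤w 0<Σ (average L)
  ... | e , we>0 , down = e ∷ L , we>0 ∷ w>0 , ≤-trans down bound
... | L , w>0 , bound = L , w>0 , λ S → ≤-trans (term≤ΣSub (λ S → prodOver-nonNeg L (0≤f S)) S) bound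

-- Tail bound for one tilt

⅛ : ℚ
⅛ = ℤ.+ 1 / 8

-- The condition that the absolute value of `d` is at most 1/8, split into two nonnegative forms
-- that can serve directly as factors in the certificates below. It is symmetric in `d`, so one tail
-- bound covers both tails.
record IsTilt (d : ℚ) : Set where
  constructor _,_
  field
    0≤1+8d : 0ℚ ≤ 1ℚ + 8ℚ * d
    0≤1-8d : 0ℚ ≤ 1ℚ - 8ℚ * d

InUnit : ℚ → Set
InUnit z = 0ℚ ≤ z × z ≤ 1ℚ

neg-tilt : ∀ {d} → IsTilt d → IsTilt (- d)
neg-tilt {d} (p , q) = subst (0ℚ ≤_) (solve 1 (λ d → con 1ℚ :- con 8ℚ :* d := con 1ℚ :+ con 8ℚ :* (:- d)) refl d) q
                     , subst (0ℚ ≤_) (solve 1 (λ d → con 1ℚ :+ con 8ℚ :* d := con 1ℚ :- con 8ℚ :* (:- d)) refl d) p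

-- The factor by which a sampled value y multiplies the potential; its mean is 1 when y has mean μ.
factor : ℚ → ℚ → ℚ → ℚ
factor d μ y = (1ℚ + d * y) * inv (1ℚ + d * μ)

module _ {d : ℚ} (tilt : IsTilt d) where
  open IsTilt tilt

  1+dz-pos : ∀ {z} → InUnit z → 0ℚ < 1ℚ + d * z
  -- 7/8 is the least value of `1ℚ + d * z`, reached at `d = -1/8` and `z = 1`.
  1+dz-pos {z} (0≤z , z≤1) = <-≤-trans (positive⁻¹ (ℤ.+ 7 / 8)) (≤-by (⅛ * ((1ℚ - z) + z * (1ℚ + 8ℚ * d)))
    (*-nonNeg (nonNegative⁻¹ ⅛) (+-nonNeg (p≤q⇒0≤q-p z≤1) (*-nonNeg 0≤z 0≤1+8d)))
    (solve 2 (λ d z → con 1ℚ :+ d :* z := con (ℤ.+ 7 / 8) :+ con ⅛ :* ((con 1ℚ :- z) :+ z :* (con 1ℚ :+ con 8ℚ :* d))) refl d z))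

  0≤1+2d : 0ℚ ≤ 1ℚ + 2ℚ * d
  0≤1+2d = ≤-trans (nonNegative⁻¹ ½) (≤-by (ℤ.+ 1 / 4 * ((1ℚ + 8ℚ * d) + 1ℚ))
    (*-nonNeg (nonNegative⁻¹ (ℤ.+ 1 / 4)) (+-nonNeg 0≤1+8d (nonNegative⁻¹ 1ℚ)))
    (solve 1 (λ d → con 1ℚ :+ con 2ℚ :* d := con ½ :+ con (ℤ.+ 1 / 4) :* ((con 1ℚ :+ con 8ℚ :* d) :+ con 1ℚ)) refl d))

module _ {d : ℚ} (tilt : IsTilt d) {μ : ℚ} (μ∈ : InUnit μ) where
  open IsTilt tilt

  factor-nonNeg : ∀ {y} → InUnit y → 0ℚ ≤ factor d μ y
  factor-nonNeg y∈ = *-nonNeg (<⇒≤ (1+dz-pos tilt y∈)) (inv-nonNeg (<⇒≤ (1+dz-pos tilt μ∈)))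

  private
    0≤1-2d : 0ℚ ≤ 1ℚ - 2ℚ * d
    0≤1-2d = subst (0ℚ ≤_) (solve 1 (λ d → con 1ℚ :+ con 2ℚ :* (:- d) := con 1ℚ :- con 2ℚ :* d) refl d) (0≤1+2d (neg-tilt tilt))

    0≤1+dμ : 0ℚ ≤ 1ℚ + d * μ
    0≤1+dμ = <⇒≤ (1+dz-pos tilt μ∈)

    a b : ℚ
    a = 1ℚ + d * μ
    b = - ((1ℚ + d * μ) * (d * (1ℚ - 2ℚ * d)))

    -- A linear upper bound for 1 / factor
    c : ℚ → ℚ
    c y = a + b * y

    c-nonNeg : ∀ {y} → InUnit y → 0ℚ ≤ c y
    c-nonNeg {y} (0≤y , y≤1) = subst (0ℚ ≤_)
      (solve 3 (λ d u y → (con 1ℚ :+ d :* u) :* ((con 1ℚ :- y) :+ y :* (con 2ℚ :* (d :* d) :+ (con 1ℚ :+ (:- d) :* con 1ℚ)))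
        := (con 1ℚ :+ d :* u) :+ (:- ((con 1ℚ :+ d :* u) :* (d :* (con 1ℚ :- con 2ℚ :* d)))) :* y) refl d μ y)
      (*-nonNeg 0≤1+dμ (+-nonNeg (p≤q⇒0≤q-p y≤1) (*-nonNeg 0≤y (+-nonNeg (*-nonNeg (nonNegative⁻¹ 2ℚ) (square-nonNeg d))
        (<⇒≤ (1+dz-pos (neg-tilt tilt) (nonNegative⁻¹ 1ℚ , ≤-refl)))))))

    -- After cancelling `a` the claim is that `(1 + d y) (1 - d (1 - 2 d) y)` is at least 1: the
    -- first-order terms leave `2 d² y`, which dominates the quadratic loss on the unit interval.
    -- Linearity of `c` matters because its sum over a sample then depends only on the sum of the
    -- `y`.
    1≤factor*c : ∀ {y} → InUnit y → 1ℚ ≤ factor d μ y * c y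
    1≤factor*c {y} (0≤y , y≤1) = ≤-by (d * d * (y * ((1ℚ - y) + (1ℚ - y) + y * (1ℚ + 2ℚ * d))))
      (*-nonNeg (square-nonNeg d) (*-nonNeg 0≤y (+-nonNeg (+-nonNeg 0≤1-y 0≤1-y) (*-nonNeg 0≤y (0≤1+2d tilt)))))
      (begin
        (1ℚ + d * y) * inv a * c y
          ≡⟨ solve 4 (λ d y a i → (con 1ℚ :+ d :* y) :* i :* (a :+ (:- (a :* (d :* (con 1ℚ :- con 2ℚ :* d)))) :* y)
               := (a :* i) :* ((con 1ℚ :+ d :* y) :* (con 1ℚ :- d :* (con 1ℚ :- con 2ℚ :* d) :* y))) refl d y a (inv a) ⟩
        a * inv a * ((1ℚ + d * y) * (1ℚ - d * (1ℚ - 2ℚ * d) * y))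
          ≡⟨ cong (_* ((1ℚ + d * y) * (1ℚ - d * (1ℚ - 2ℚ * d) * y))) (*-inv (λ a≡0 → <-irrefl (sym a≡0) (1+dz-pos tilt μ∈))) ⟩
        1ℚ * ((1ℚ + d * y) * (1ℚ - d * (1ℚ - 2ℚ * d) * y))
          ≡⟨ solve 2 (λ d y → con 1ℚ :* ((con 1ℚ :+ d :* y) :* (con 1ℚ :- d :* (con 1ℚ :- con 2ℚ :* d) :* y))
               := con 1ℚ :+ d :* d :* (y :* ((con 1ℚ :- y) :+ (con 1ℚ :- y) :+ y :* (con 1ℚ :+ con 2ℚ :* d)))) refl d y ⟩
        1ℚ + d * d * (y * ((1ℚ - y) + (1ℚ - y) + y * (1ℚ + 2ℚ * d)))  ∎)
      where
      open ≡-Reasoning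
      0≤1-y : 0ℚ ≤ 1ℚ - y
      0≤1-y = p≤q⇒0≤q-p y≤1

  0≤1-4ddμ : 0ℚ ≤ 1ℚ - 4ℚ * (d * d) * μ
  0≤1-4ddμ = subst (0ℚ ≤_)
    (solve 2 (λ d u → (con 1ℚ :- u) :+ u :* ((con 1ℚ :+ con 2ℚ :* d) :* (con 1ℚ :- con 2ℚ :* d)) := con 1ℚ :- con 4ℚ :* (d :* d) :* u) refl d μ)
    (+-nonNeg (p≤q⇒0≤q-p (proj₂ μ∈)) (*-nonNeg (proj₁ μ∈) (*-nonNeg (0≤1+2d tilt) 0≤1-2d)))

  -- If the conclusion fails, the mean of `c` is at most `1 - 4 d² μ`, and AM-GM bounds the product
  -- of the `c` by the `N`-th power of that. Multiplied by the product of the factors this falls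
  -- below 1, against `1≤factor*c`. Positive `d` gives the upper tail, negative `d` the lower one.
  tail-bound : ∀ {A : Set} {y : A → ℚ} {N} (L : Vec A N) {B} → (∀ e → InUnit (y e)) →
    prodOver (λ e → factor d μ (y e)) L ≤ B → B * (1ℚ - 4ℚ * (d * d) * μ) ^ N < 1ℚ →
    d * sumOver y L ≤ (d + 8ℚ * (d * d)) * (μ * ℕ→ℚ N)
  tail-bound {A} {y} {N} L {B} y∈ small decay with d * sumOver y L ≤? (d + 8ℚ * (d * d)) * (μ * ℕ→ℚ N)
  ... | yes ok = ok
  ... | no  large = ⊥-elim (<-irrefl refl (begin-strict
    1ℚ
      ≤⟨ 1≤prodOver*prodOver {f = λ e → factor d μ (y e)} {λ e → c (y e)} L (λ e → 1≤factor*c (y∈ e)) ⟩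
    prodOver (λ e → factor d μ (y e)) L * prodOver (λ e → c (y e)) L
      ≤⟨ *-monoʳ _ (prodOver-nonNeg L (λ e → c-nonNeg (y∈ e))) small ⟩
    B * prodOver (λ e → c (y e)) L
      ≤⟨ *-monoˡ B 0≤B (AM-GM L (λ e → c-nonNeg (y∈ e)) 0≤1-4ddμ mean-c) ⟩
    B * (1ℚ - 4ℚ * (d * d) * μ) ^ N                                <⟨ decay ⟩
    1ℚ                                                             ∎))
    where
    open ≤-Reasoning
    0≤B : 0ℚ ≤ B
    0≤B = ≤-trans (prodOver-nonNeg L (λ e → factor-nonNeg (y∈ e))) small
    Y = sumOver y L
    M = ℕ→ℚ N
    excess = d * Y - (d + 8ℚ * (d * d)) * (μ * M)
    -- Apart from the multiple of `excess`, expanding `(1 - 2 d) (d + 8 d²)` yields a second-order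
    -- coefficient `8 - 2 = 6`. The rate uses 4 of it, and the remaining 2 absorbs the cubic term as
    -- `2 μ (1 - 8 d)`; this is what fixes the constants 4 and 8.
    mean-c : sumOver (λ e → c (y e)) L ≤ M * (1ℚ - 4ℚ * (d * d) * μ)
    mean-c = ≤-by
      ((1ℚ + d * μ) * (1ℚ - 2ℚ * d) * excess
        + M * (d * d * (2ℚ * (μ * (1ℚ - 8ℚ * d)) + μ * μ * ((1ℚ - 2ℚ * d) * (1ℚ + 8ℚ * d)))))
      (+-nonNeg (*-nonNeg (*-nonNeg 0≤1+dμ 0≤1-2d) (p≤q⇒0≤q-p (<⇒≤ (≰⇒> large))))
        (*-nonNeg (ℕ→ℚ-nonNeg N) (*-nonNeg (square-nonNeg d) (+-nonNeg
          (*-nonNeg (nonNegative⁻¹ 2ℚ) (*-nonNeg (proj₁ μ∈) 0≤1-8d))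
          (*-nonNeg (square-nonNeg μ) (*-nonNeg 0≤1-2d 0≤1+8d))))))
      (trans
        (solve 4 (λ d u Y M → M :* (con 1ℚ :- con 4ℚ :* (d :* d) :* u) :=
          M :* (con 1ℚ :+ d :* u) :+ (:- ((con 1ℚ :+ d :* u) :* (d :* (con 1ℚ :- con 2ℚ :* d)))) :* Y
          :+ ((con 1ℚ :+ d :* u) :* (con 1ℚ :- con 2ℚ :* d) :* (d :* Y :- (d :+ con 8ℚ :* (d :* d)) :* (u :* M))
            :+ M :* (d :* d :* (con 2ℚ :* (u :* (con 1ℚ :- con 8ℚ :* d)) :+ u :* u :* ((con 1ℚ :- con 2ℚ :* d) :* (con 1ℚ :+ con 8ℚ :* d))))))
          refl d μ Y M)
        (cong (_+ ((1ℚ + d * μ) * (1ℚ - 2ℚ * d) * excess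
        + M * (d * d * (2ℚ * (μ * (1ℚ - 8ℚ * d)) + μ * μ * ((1ℚ - 2ℚ * d) * (1ℚ + 8ℚ * d)))))) (sym (sumOver-affine a b y L))))

-- Sampling for all vertex sets at once

-- The power splits into `suc j` blocks of `k` factors, each block at most 1/2. The one block beyond
-- `j` makes the inequality strict.
2^j*[1-x]^N<1 : ∀ {x} j k → 0ℚ ≤ x → x ≤ 1ℚ → 1ℚ ≤ ℕ→ℚ k * x → 2ℚ ^ j * (1ℚ - x) ^ (suc j ℕ.* k) < 1ℚ
2^j*[1-x]^N<1 {x} j k 0≤x x≤1 1≤kx = *-cancelˡ-<-nonNeg 2ℚ (≤-<-trans (begin
  2ℚ * (2ℚ ^ j * (1ℚ - x) ^ (suc j ℕ.* k))   ≡⟨ cong (λ z → 2ℚ * (2ℚ ^ j * z)) (^-* (1ℚ - x) (suc j) k) ⟩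
  2ℚ * (2ℚ ^ j * ((1ℚ - x) ^ k) ^ suc j)       ≡⟨ *-assoc 2ℚ (2ℚ ^ j) (((1ℚ - x) ^ k) ^ suc j) ⟨
  2ℚ ^ suc j * ((1ℚ - x) ^ k) ^ suc j          ≡⟨ ^-distrib-* 2ℚ ((1ℚ - x) ^ k) (suc j) ⟨
  (2ℚ * (1ℚ - x) ^ k) ^ suc j
    ≤⟨ ^-≤1 (suc j) (*-nonNeg (nonNegative⁻¹ 2ℚ) (^-nonNeg k (p≤q⇒0≤q-p x≤1)))
          (2*[1-x]^k≤1 k 0≤x x≤1 1≤kx) ⟩
  1ℚ                                           ∎) (*<* (ℤ.+<+ (ℕ.s≤s (ℕ.s≤s ℕ.z≤n)))))
  where open ≤-Reasoning

module _ {m} {w : Fin m → ℚ} {μ} (μ∈ : InUnit μ) (μ*Σw≡1 : μ * Σℚ w ≡ 1ℚ) where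

  -- Under the probabilities `w e / Σℚ w` the mean of `y` is `1 / Σℚ w`, that is `μ`; `factor` is
  -- affine in `y` and normalised at `μ`.
  factor-average : ∀ {d} → IsTilt d → (y : Fin m → ℚ) → Σℚ (λ e → w e * y e) ≡ 1ℚ →
    Σℚ (λ e → w e * factor d μ (y e)) ≡ Σℚ w
  factor-average {d} tilt y avg = begin
    Σℚ (λ e → w e * ((1ℚ + d * y e) * i))
      ≡⟨ Σℚ-cong (λ e → solve 4 (λ w d y i → w :* ((con 1ℚ :+ d :* y) :* i) := (w :+ d :* (w :* y)) :* i) refl (w e) d (y e) i) ⟩
    Σℚ (λ e → (w e + d * (w e * y e)) * i)         ≡⟨ Σℚ-*ʳ (λ e → w e + d * (w e * y e)) i ⟩
    Σℚ (λ e → w e + d * (w e * y e)) * i           ≡⟨ cong (_* i) (Σℚ-+ w (λ e → d * (w e * y e))) ⟩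
    (Σℚ w + Σℚ (λ e → d * (w e * y e))) * i
      ≡⟨ cong (λ z → (Σℚ w + z) * i) (Σℚ-*ˡ d (λ e → w e * y e)) ⟩
    (Σℚ w + d * Σℚ (λ e → w e * y e)) * i
      ≡⟨ cong (λ z → (Σℚ w + d * z) * i) (trans avg (sym μ*Σw≡1)) ⟩
    (Σℚ w + d * (μ * Σℚ w)) * i
      ≡⟨ solve 4 (λ W d u i → (W :+ d :* (u :* W)) :* i := W :* ((con 1ℚ :+ d :* u) :* i)) refl (Σℚ w) d μ i ⟩
    Σℚ w * ((1ℚ + d * μ) * i)
      ≡⟨ cong (Σℚ w *_) (*-inv (λ a≡0 → <-irrefl (sym a≡0) (1+dz-pos tilt μ∈))) ⟩
    Σℚ w * 1ℚ                                      ≡⟨ *-identityʳ (Σℚ w) ⟩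
    Σℚ w                                           ∎
    where
    open ≡-Reasoning
    i = inv (1ℚ + d * μ)

  -- One selection controls both tails for every set. It runs over `2 ^ suc n` pairs of a sign and a
  -- set, and `2^j*[1-x]^N<1` then asks for one further block, hence `suc (suc n)` blocks of `k`
  -- draws.
  sampling : ∀ {n} (y : Subset n → Fin m → ℚ) → (∀ e → 0ℚ ≤ w e) → (∀ S e → InUnit (y S e)) →
    (∀ S → Σℚ (λ e → w e * y S e) ≡ 1ℚ) →
    ∀ {d} → 0ℚ < d → IsTilt d → ∀ k → 1ℚ ≤ ℕ→ℚ k * (4ℚ * (d * d) * μ) →
    let N = suc (suc n) ℕ.* k in
    Σ (Vec (Fin m) N) λ L → All (λ e → 0ℚ < w e) L ×
      (∀ S → (1ℚ - 8ℚ * d) * (μ * ℕ→ℚ N) ≤ sumOver (y S) L × sumOver (y S) L ≤ (1ℚ + 8ℚ * d) * (μ * ℕ→ℚ N))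
  sampling {n} y 0≤w y∈ avg {d} 0<d tilt k 1≤kx = finish (select w f 0≤w 0<Σw 0≤f favg N)
    where
    N = suc (suc n) ℕ.* k
    x = 4ℚ * (d * d) * μ
    -- The additional leading bit encodes the sign of the tilt.
    f : Subset (suc n) → Fin m → ℚ
    f (true  ∷ S) e = factor d μ (y S e)
    f (false ∷ S) e = factor (- d) μ (y S e)
    0≤f : ∀ S e → 0ℚ ≤ f S e
    0≤f (true  ∷ S) e = factor-nonNeg tilt μ∈ (y∈ S e)
    0≤f (false ∷ S) e = factor-nonNeg (neg-tilt tilt) μ∈ (y∈ S e)
    favg : ∀ S → Σℚ (λ e → w e * f S e) ≡ Σℚ w
    favg (true  ∷ S) = factor-average tilt (y S) (avg S)
    favg (false ∷ S) = factor-average (neg-tilt tilt) (y S) (avg S)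
    0<Σw : 0ℚ < Σℚ w
    0<Σw = ≢0⇒pos (Σℚ-nonNeg 0≤w) λ Σw≡0 →
      <-irrefl (trans (sym (*-zeroʳ μ)) (trans (cong (μ *_) (sym Σw≡0)) μ*Σw≡1)) (positive⁻¹ 1ℚ)
    0≤x : 0ℚ ≤ x
    0≤x = *-nonNeg (*-nonNeg (nonNegative⁻¹ 4ℚ) (square-nonNeg d)) (proj₁ μ∈)
    x≤1 : x ≤ 1ℚ
    x≤1 = ≤-by (1ℚ - x) (0≤1-4ddμ tilt μ∈) (solve 1 (λ x → con 1ℚ := x :+ (con 1ℚ :- x)) refl x)
    decay : 2ℚ ^ suc n * (1ℚ - x) ^ N < 1ℚ
    decay = 2^j*[1-x]^N<1 (suc n) k 0≤x x≤1 1≤kx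
    decay⁻ : 2ℚ ^ suc n * (1ℚ - 4ℚ * (- d * - d) * μ) ^ N < 1ℚ
    decay⁻ = subst (λ z → 2ℚ ^ suc n * (1ℚ - 4ℚ * z * μ) ^ N < 1ℚ) (solve 1 (λ d → d :* d := (:- d) :* (:- d)) refl d) decay
    finish : (Σ (Vec (Fin m) N) λ L → All (λ e → 0ℚ < w e) L × (∀ S → prodOver (f S) L ≤ 2ℚ ^ suc n)) → _
    finish (L , w>0 , bounds) = L , w>0 , λ S → lower S , upper S
      where
      upper : ∀ S → sumOver (y S) L ≤ (1ℚ + 8ℚ * d) * (μ * ℕ→ℚ N)
      upper S = *-cancelˡ-≤-pos d {{positive 0<d}} (subst (d * sumOver (y S) L ≤_)
        (solve 2 (λ d M → (d :+ con 8ℚ :* (d :* d)) :* M := d :* ((con 1ℚ :+ con 8ℚ :* d) :* M)) refl d (μ * ℕ→ℚ N))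
        (tail-bound tilt μ∈ L (y∈ S) (bounds (true ∷ S)) decay))
      -- The tail bound at `- d` reads `- d Y ≤ (- d + 8 d²) μ N`; moving terms across and
      -- cancelling `d` turns it into a lower bound.
      lower : ∀ S → (1ℚ - 8ℚ * d) * (μ * ℕ→ℚ N) ≤ sumOver (y S) L
      lower S = *-cancelˡ-≤-pos d {{positive 0<d}} (≤-by _
        (p≤q⇒0≤q-p (tail-bound (neg-tilt tilt) μ∈ L (y∈ S) (bounds (false ∷ S)) decay⁻))
        (solve 3 (λ d Y M → d :* Y := d :* ((con 1ℚ :- con 8ℚ :* d) :* M) :+
            (((:- d) :+ con 8ℚ :* ((:- d) :* (:- d))) :* M :- (:- d) :* Y)) refl d (sumOver (y S) L) (μ * ℕ→ℚ N)))

-- Multiplicities and support of a sample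

sumOver-*ˡ : ∀ {A : Set} {N} c (f : A → ℚ) (L : Vec A N) → sumOver (λ e → c * f e) L ≡ c * sumOver f L
sumOver-*ˡ c f []      = sym (*-zeroʳ c)
sumOver-*ˡ c f (e ∷ L) = trans (cong (c * f e +_) (sumOver-*ˡ c f L)) (sym (*-distribˡ-+ c (f e) (sumOver f L)))

-- The Kronecker delta. It counts repeated draws, and `δ zero` also serves as a default probability
-- distribution on edges.
δ : ∀ {m} → Fin m → Fin m → ℚ
δ zero    zero    = 1ℚ
δ zero    (suc j) = 0ℚ
δ (suc i) zero    = 0ℚ
δ (suc i) (suc j) = δ i j

δ-nonNeg : ∀ {m} (i j : Fin m) → 0ℚ ≤ δ i j
δ-nonNeg zero    zero    = nonNegative⁻¹ 1ℚ
δ-nonNeg zero    (suc j) = ≤-refl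
δ-nonNeg (suc i) zero    = ≤-refl
δ-nonNeg (suc i) (suc j) = δ-nonNeg i j

δ-refl : ∀ {m} (i : Fin m) → δ i i ≡ 1ℚ
δ-refl zero    = refl
δ-refl (suc i) = δ-refl i

δ-≢ : ∀ {m} {i j : Fin m} → i ≢ j → δ i j ≡ 0ℚ
δ-≢ {i = zero}  {zero}  i≢j = ⊥-elim (i≢j refl)
δ-≢ {i = zero}  {suc j} i≢j = refl
δ-≢ {i = suc i} {zero}  i≢j = refl
δ-≢ {i = suc i} {suc j} i≢j = δ-≢ (i≢j ∘ cong suc)

Σℚ-zero : ∀ {m} {f : Fin m → ℚ} → (∀ i → f i ≡ 0ℚ) → Σℚ f ≡ 0ℚ
Σℚ-zero {m} f≡0 = trans (Σℚ-cong f≡0) (trans (Σℚ-const m 0ℚ) (*-zeroʳ (ℕ→ℚ m)))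

Σℚ-δ : ∀ {m} (i : Fin m) (f : Fin m → ℚ) → Σℚ (λ j → δ i j * f j) ≡ f i
Σℚ-δ zero    f = trans (cong₂ _+_ (*-identityˡ (f zero)) (Σℚ-zero (λ j → *-zeroˡ (f (suc j))))) (+-identityʳ (f zero))
Σℚ-δ (suc i) f = trans (+-zeroˡ (*-zeroˡ (f zero)) _) (Σℚ-δ i (λ j → f (suc j)))

count : ∀ {m N} → Vec (Fin m) N → Fin m → ℚ
count L e = sumOver (λ e′ → δ e′ e) L

-- Used to turn a reweighted cut, a sum over edges, into a sum over the draws, to which the
-- concentration bounds apply.
Σℚ-count : ∀ {m N} (L : Vec (Fin m) N) (f : Fin m → ℚ) → Σℚ (λ e → count L e * f e) ≡ sumOver f L
Σℚ-count []       f = Σℚ-zero (λ e → *-zeroˡ (f e))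
Σℚ-count (e′ ∷ L) f = begin
  Σℚ (λ e → (δ e′ e + count L e) * f e)
    ≡⟨ Σℚ-cong (λ e → *-distribʳ-+ (f e) (δ e′ e) (count L e)) ⟩
  Σℚ (λ e → δ e′ e * f e + count L e * f e)
    ≡⟨ Σℚ-+ (λ e → δ e′ e * f e) (λ e → count L e * f e) ⟩
  Σℚ (λ e → δ e′ e * f e) + Σℚ (λ e → count L e * f e)  ≡⟨ cong₂ _+_ (Σℚ-δ e′ f) (Σℚ-count L f) ⟩
  f e′ + sumOver f L                                     ∎
  where open ≡-Reasoning

support : ∀ {m N} → Vec (Fin m) N → Subset m
support []      = ⊥
support (e ∷ L) = ⁅ e ⁆ ∪ support L

∣⁅x⁆∪p∣≤1+∣p∣ : ∀ {m} (x : Fin m) p → ∣ ⁅ x ⁆ ∪ p ∣ ℕ.≤ suc ∣ p ∣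
∣⁅x⁆∪p∣≤1+∣p∣ zero    (b ∷ p) rewrite ∪-identityˡ p = ℕ.s≤s (∣p∣≤∣x∷p∣ b p)
∣⁅x⁆∪p∣≤1+∣p∣ (suc x) (outside ∷ p) = ∣⁅x⁆∪p∣≤1+∣p∣ x p
∣⁅x⁆∪p∣≤1+∣p∣ (suc x) (inside ∷ p)  = ℕ.s≤s (∣⁅x⁆∪p∣≤1+∣p∣ x p)

∣support∣≤ : ∀ {m N} (L : Vec (Fin m) N) → ∣ support L ∣ ℕ.≤ N
∣support∣≤ {m} []  = ℕ.≤-reflexive (∣⊥∣≡0 m)
∣support∣≤ (e ∷ L) = ℕ.≤-trans (∣⁅x⁆∪p∣≤1+∣p∣ e (support L)) (ℕ.s≤s (∣support∣≤ L))

count-nonNeg : ∀ {m N} (L : Vec (Fin m) N) e → 0ℚ ≤ count L e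
count-nonNeg L e = sumOver-nonNeg L (λ e′ → δ-nonNeg e′ e)

∈-support⇒count-pos : ∀ {m N} (L : Vec (Fin m) N) {e} → e ∈ support L → 0ℚ < count L e
∈-support⇒count-pos []       e∈ = ⊥-elim (∉⊥ e∈)
∈-support⇒count-pos (e′ ∷ L) {e} e∈ with x∈p∪q⁻ ⁅ e′ ⁆ (support L) e∈
... | inj₁ e∈⁅e′⁆ rewrite x∈⁅y⁆⇒x≡y e′ e∈⁅e′⁆ | δ-refl e′ = +-mono-<-≤ {0ℚ} {1ℚ} {0ℚ} (positive⁻¹ 1ℚ) (count-nonNeg L e′)
... | inj₂ e∈L = +-mono-≤-< {0ℚ} {_} {0ℚ} (δ-nonNeg e′ e) (∈-support⇒count-pos L e∈L)

∉-support⇒count-zero : ∀ {m N} (L : Vec (Fin m) N) {e} → e ∉ support L → count L e ≡ 0ℚ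
∉-support⇒count-zero []       e∉ = refl
∉-support⇒count-zero (e′ ∷ L) {e} e∉ = trans
  (+-zeroˡ (δ-≢ {i = e′} {e} (λ { refl → e∉ (x∈p∪q⁺ {p = ⁅ e ⁆} {support L} (inj₁ (x∈⁅x⁆ e))) })) (count L e))
  (∉-support⇒count-zero L (λ e∈L → e∉ (x∈p∪q⁺ {p = ⁅ e′ ⁆} {support L} (inj₂ e∈L))))

All-support : ∀ {m N} {P : Fin m → Set} {L : Vec (Fin m) N} → All P L → ∀ {e} → e ∈ support L → P e
All-support []                          e∈ = ⊥-elim (∉⊥ e∈)
All-support {P = P} {e′ ∷ L} (pe′ ∷ pL) e∈ with x∈p∪q⁻ ⁅ e′ ⁆ (support L) e∈
... | inj₁ e∈⁅e′⁆ = subst P (sym (x∈⁅y⁆⇒x≡y e′ e∈⁅e′⁆)) pe′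
... | inj₂ e∈L    = All-support pL e∈L

-- Subadditivity and normalised shares

-- Vertices are split off one at a time. As `b` is nonnegative, vertices outside `S` can be included
-- too, so that the right-hand side does not depend on `S` through its range of summation.
subadditive-bound : ∀ {n} (h : Subset n → ℚ) (b : Fin n → ℚ) → h ⊥ ≤ 0ℚ → (∀ S T → h (S ∪ T) ≤ h S + h T) →
  (∀ v → 0ℚ ≤ b v) → ∀ S → (∀ v → v ∈ S → h ⁅ v ⁆ ≤ b v) → h S ≤ Σℚ b
subadditive-bound h b h⊥≤0 subadd 0≤b [] h≤b = h⊥≤0
subadditive-bound {suc n} h b h⊥≤0 subadd 0≤b (x ∷ S) h≤b = go x (h≤b zero)
  where
  rest : h (outside ∷ S) ≤ Σℚ (λ v → b (suc v))
  rest = subadditive-bound (λ T → h (outside ∷ T)) (λ v → b (suc v)) h⊥≤0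
    (λ T U → subadd (outside ∷ T) (outside ∷ U)) (λ v → 0≤b (suc v)) S (λ v v∈S → h≤b (suc v) (there v∈S))
  go : ∀ x → (zero ∈ x ∷ S → h ⁅ zero ⁆ ≤ b zero) → h (x ∷ S) ≤ Σℚ b
  go outside _ = ≤-trans rest (≤-by (b zero) (0≤b zero) (+-comm (b zero) (Σℚ (λ v → b (suc v)))))
  go inside  h≤b₀ = subst (λ T → h (inside ∷ T) ≤ Σℚ b) (∪-identityˡ S)
    (≤-trans (subadd ⁅ zero ⁆ (outside ∷ S)) (+-mono-≤ (h≤b₀ here) rest))

-- The default r keeps Σ w = n and the mean of y equal to 1/n even where a cut vanishes.
share : ∀ {m} → (a r : Fin m → ℚ) → Fin m → ℚ
share a r e with Σℚ a ≟ 0ℚ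
... | yes _ = r e
... | no  _ = a e * inv (Σℚ a)

module _ {m} {a : Fin m → ℚ} (0≤a : ∀ e → 0ℚ ≤ a e) where

  Σ≡0⇒term≡0 : Σℚ a ≡ 0ℚ → ∀ e → a e ≡ 0ℚ
  Σ≡0⇒term≡0 Σ≡0 e = ≤-antisym (≤-trans (term≤Σℚ 0≤a e) (≤-reflexive Σ≡0)) (0≤a e)

  module _ {r : Fin m → ℚ} where

    share-nonNeg : (∀ e → 0ℚ ≤ r e) → ∀ e → 0ℚ ≤ share a r e
    share-nonNeg 0≤r e with Σℚ a ≟ 0ℚ
    ... | yes _ = 0≤r e
    ... | no  _ = *-nonNeg (0≤a e) (inv-nonNeg (Σℚ-nonNeg 0≤a))

    Σℚ-share : Σℚ r ≡ 1ℚ → Σℚ (share a r) ≡ 1ℚ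
    Σℚ-share Σr≡1 with Σℚ a ≟ 0ℚ
    ... | yes _   = Σr≡1
    ... | no  Σ≢0 = trans (Σℚ-*ʳ a (inv (Σℚ a))) (*-inv Σ≢0)

    -- Survives a vanishing total whatever the default `r`, because nonnegative terms with sum 0 are
    -- all 0.
    Σ*share : ∀ e → Σℚ a * share a r e ≡ a e
    Σ*share e with Σℚ a ≟ 0ℚ
    ... | yes Σ≡0 = trans (*-annihˡ Σ≡0 (r e)) (sym (Σ≡0⇒term≡0 Σ≡0 e))
    ... | no  Σ≢0 = trans (solve 3 (λ s a i → s :* (a :* i) := a :* (s :* i)) refl (Σℚ a) (a e) (inv (Σℚ a)))
                      (trans (cong (a e *_) (*-inv Σ≢0)) (*-identityʳ (a e)))

    share-≤ : ∀ {e c} → r e ≤ c → a e ≤ Σℚ a * c → share a r e ≤ c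
    share-≤ {e} {c} r≤c a≤Σc with Σℚ a ≟ 0ℚ
    ... | yes _   = r≤c
    ... | no  Σ≢0 = ≤-trans (*-monoʳ (inv (Σℚ a)) (inv-nonNeg (Σℚ-nonNeg 0≤a)) a≤Σc) (≤-reflexive
        (trans (solve 3 (λ s c i → s :* c :* i := c :* (s :* i)) refl (Σℚ a) c (inv (Σℚ a)))
          (trans (cong (c *_) (*-inv Σ≢0)) (*-identityʳ c))))

-- Cuts and reweighted cuts

-- The summand is local to reweightedCut and cannot be named; unification recovers it.
reweightedCut-terms : ∀ {n m} (H : SubmodularHypergraph n m) E′ s S → Σ (Fin m → ℚ) λ f → Σℚ f ≡ reweightedCut H E′ s S
reweightedCut-terms H E′ s S = _ , refl

-- With weights 0 off the subgraph, the case distinction on membership disappears and the cut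
-- becomes a plain weighted sum.
reweightedCut-≡ : ∀ {n m} (H : SubmodularHypergraph n m) E′ s → (∀ i → i ∉ E′ → s i ≡ 0ℚ) →
  ∀ S → reweightedCut H E′ s S ≡ Σℚ (λ i → s i * g H i (S ∩ edge H i))
reweightedCut-≡ H E′ s off S = trans (sym (proj₂ terms)) (Σℚ-cong pointwise)
  where
  terms = reweightedCut-terms H E′ s S
  pointwise : ∀ i → proj₁ terms i ≡ s i * g H i (S ∩ edge H i)
  pointwise i with lookup E′ i in eq
  ... | inside  = refl
  ... | outside = sym (*-annihˡ (off i (λ i∈E′ → contra (trans (sym eq) ([]=⇒lookup i∈E′)))) (g H i (S ∩ edge H i)))
    where
    contra : outside ≢ inside
    contra ()

module _ {n m} (H : SubmodularHypergraph n m) where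

  restricted : Fin m → Subset n → ℚ
  restricted e S = g H e (S ∩ edge H e)

  restricted-nonNeg : ∀ e S → 0ℚ ≤ restricted e S
  restricted-nonNeg e S = proj₁ (proj₂ (g-splitting H e)) (S ∩ edge H e) (p∩q⊆q S (edge H e))

  restricted-⊥ : ∀ e → restricted e ⊥ ≡ 0ℚ
  restricted-⊥ e = trans (cong (g H e) (∩-zeroˡ (edge H e))) (proj₁ (g-splitting H e))

  -- Submodularity of `g` on the traces of `S` and `T` on the edge, with the nonnegative
  -- intersection term dropped.
  restricted-subadditive : ∀ e S T → restricted e (S ∪ T) ≤ restricted e S + restricted e T
  restricted-subadditive e S T = begin
    g H e ((S ∪ T) ∩ E)                          ≡⟨ cong (g H e) (∩-distribʳ-∪ E S T) ⟩
    g H e ((S ∩ E) ∪ (T ∩ E))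
      ≤⟨ ≤-by (g H e ((S ∩ E) ∩ (T ∩ E))) (g≥0 _ (λ x∈ → S∩E⊆E (p∩q⊆p (S ∩ E) (T ∩ E) x∈))) refl ⟩
    g H e ((S ∩ E) ∪ (T ∩ E)) + g H e ((S ∩ E) ∩ (T ∩ E)) ≤⟨ submodular (S ∩ E) (T ∩ E) S∩E⊆E (p∩q⊆q T E) ⟩
    g H e (S ∩ E) + g H e (T ∩ E)                ∎
    where
    open ≤-Reasoning
    E = edge H e
    g≥0 = proj₁ (proj₂ (g-splitting H e))
    submodular = proj₂ (proj₂ (g-splitting H e))
    S∩E⊆E : S ∩ E ⊆ E
    S∩E⊆E = p∩q⊆q S E

  restricted-mono : AllMonotone H → ∀ e {S T} → S ⊆ T → restricted e S ≤ restricted e T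
  restricted-mono mono e {S} {T} S⊆T = mono e (S ∩ E) (T ∩ E) (p∩q⊆q S E) (p∩q⊆q T E)
    (λ x∈ → x∈p∩q⁺ (S⊆T (p∩q⊆p S E x∈) , p∩q⊆q S E x∈))
    where E = edge H e

  cut-⊥ : cut H ⊥ ≡ 0ℚ
  cut-⊥ = Σℚ-zero restricted-⊥

  cut-nonNeg : ∀ S → 0ℚ ≤ cut H S
  cut-nonNeg S = Σℚ-nonNeg (λ e → restricted-nonNeg e S)

-- The degenerate case and the sample size

-- The size bound is multiplied through by `ε * ε` to avoid a division.
Sparsifies : ∀ {n m} → SubmodularHypergraph n m → ℚ → ℚ → Set
Sparsifies {n} {m} H C ε = Σ (Subset m) λ E′ → Σ (Fin m → ℚ) λ s →
  IsReweightedSparsifier H ε E′ s × (ℕ→ℚ ∣ E′ ∣ * (ε * ε) ≤ C * (ℕ→ℚ n * ℕ→ℚ n))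

-- For hypergraphs without vertices or without edges, where there is no distribution to sample from;
-- the empty subgraph reproduces the zero cuts exactly.
empty-sparsifier : ∀ {n m} (H : SubmodularHypergraph n m) {C} ε → 0ℚ ≤ C → (∀ S → cut H S ≡ 0ℚ) → Sparsifies H C ε
empty-sparsifier {n} {m} H {C} ε 0≤C cut≡0 = ⊥ , (λ _ → 0ℚ) , ((λ i i∈⊥ → ⊥-elim (∉⊥ i∈⊥)) , both) , size
  where
  rc≡0 : ∀ S → reweightedCut H ⊥ (λ _ → 0ℚ) S ≡ 0ℚ
  rc≡0 S = trans (reweightedCut-≡ H ⊥ (λ _ → 0ℚ) (λ _ _ → refl) S) (Σℚ-zero (λ i → *-zeroˡ (restricted H i S)))
  c*cut≡0 : ∀ c S → c * cut H S ≡ 0ℚ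
  c*cut≡0 c S = trans (cong (c *_) (cut≡0 S)) (*-zeroʳ c)
  both : ∀ S → (1ℚ - ε) * cut H S ≤ reweightedCut H ⊥ (λ _ → 0ℚ) S × reweightedCut H ⊥ (λ _ → 0ℚ) S ≤ (1ℚ + ε) * cut H S
  both S = ≤-reflexive (trans (c*cut≡0 (1ℚ - ε) S) (sym (rc≡0 S)))
         , ≤-reflexive (trans (rc≡0 S) (sym (c*cut≡0 (1ℚ + ε) S)))
  size : ℕ→ℚ ∣ ⊥ {m} ∣ * (ε * ε) ≤ C * (ℕ→ℚ n * ℕ→ℚ n)
  size = ≤-trans (≤-reflexive (*-annihˡ (cong ℕ→ℚ (∣⊥∣≡0 m)) (ε * ε)))
    (*-nonNeg 0≤C (square-nonNeg (ℕ→ℚ n)))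

1≤ℕ→ℚ-suc : ∀ k → 1ℚ ≤ ℕ→ℚ (suc k)
1≤ℕ→ℚ-suc k = ℕ→ℚ-mono {1} {suc k} (ℕ.s≤s ℕ.z≤n)

-- ε²/16 is the decay rate 4d² of the tail bound at d = ε/8.
sampleCount : ∀ {ν ε} → 1ℚ ≤ ν → 0ℚ < ε → ε < 1ℚ → ∃ λ k →
  1ℚ ≤ ℕ→ℚ k * (4ℚ * (ε * ⅛ * (ε * ⅛)) * inv ν) × (2ℚ + ν) * ℕ→ℚ k * (ε * ε) ≤ 51ℚ * (ν * ν)
sampleCount {ν} {ε} 1≤ν 0<ε ε<1 = k , 1≤kx , size
  where
  μ = inv ν
  x = 4ℚ * (ε * ⅛ * (ε * ⅛)) * μ
  0<ν : 0ℚ < ν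
  0<ν = <-≤-trans (positive⁻¹ 1ℚ) 1≤ν
  ν≢0 : ν ≢ 0ℚ
  ν≢0 ν≡0 = <-irrefl (sym ν≡0) 0<ν
  0<x : 0ℚ < x
  0<x = *-pos (*-pos (positive⁻¹ 4ℚ) (*-pos 0<d 0<d)) (inv-pos 0<ν)
    where 0<d = *-pos 0<ε (positive⁻¹ ⅛)
  x*inv : x * inv x ≡ 1ℚ
  x*inv = *-inv (λ x≡0 → <-irrefl (sym x≡0) 0<x)
  rounded = roundUp (inv x) (inv-nonNeg (<⇒≤ 0<x))
  k = proj₁ rounded
  1≤kx : 1ℚ ≤ ℕ→ℚ k * x
  1≤kx = ≤-trans (≤-reflexive (trans (sym x*inv) (*-comm x (inv x)))) (*-monoʳ x (<⇒≤ 0<x) (proj₁ (proj₂ rounded)))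
  εε≡ : ε * ε ≡ 16ℚ * ν * x
  εε≡ = sym (trans (solve 3 (λ v e u → con 16ℚ :* v :* (con 4ℚ :* (e :* con ⅛ :* (e :* con ⅛)) :* u) := e :* e :* (v :* u)) refl ν ε μ)
    (trans (cong (ε * ε *_) (*-inv ν≢0)) (*-identityʳ (ε * ε))))
  -- Here 17 is 16 + 1: `inv x` contributes `16ℚ * ν`, and rounding up costs at most `ε * ε`, which
  -- is below `ν`.
  kεε≤ : ℕ→ℚ k * (ε * ε) ≤ 17ℚ * ν
  kεε≤ = begin
    ℕ→ℚ k * (ε * ε)                     ≤⟨ *-monoʳ (ε * ε) (square-nonNeg ε) (proj₂ (proj₂ rounded)) ⟩
    (inv x + 1ℚ) * (ε * ε)
      ≡⟨ solve 2 (λ i e → (i :+ con 1ℚ) :* e := i :* e :+ e) refl (inv x) (ε * ε) ⟩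
    inv x * (ε * ε) + ε * ε             ≡⟨ cong (λ z → inv x * z + ε * ε) εε≡ ⟩
    inv x * (16ℚ * ν * x) + ε * ε
      ≡⟨ cong (_+ ε * ε) (solve 3 (λ i v x → i :* (con 16ℚ :* v :* x) := con 16ℚ :* v :* (x :* i)) refl (inv x) ν x) ⟩
    16ℚ * ν * (x * inv x) + ε * ε       ≡⟨ cong (λ z → 16ℚ * ν * z + ε * ε) x*inv ⟩
    16ℚ * ν * 1ℚ + ε * ε
      ≤⟨ +-monoʳ-≤ (16ℚ * ν * 1ℚ) (≤-trans (*-mono {s = 1ℚ} (<⇒≤ 0<ε) (nonNegative⁻¹ 1ℚ) (<⇒≤ ε<1) (<⇒≤ ε<1)) 1≤ν) ⟩
    16ℚ * ν * 1ℚ + ν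
      ≡⟨ solve 1 (λ v → con 16ℚ :* v :* con 1ℚ :+ v := con 17ℚ :* v) refl ν ⟩
    17ℚ * ν                             ∎
    where open ≤-Reasoning
  2+ν≤3ν : 2ℚ + ν ≤ 3ℚ * ν
  2+ν≤3ν = ≤-by (2ℚ * (ν - 1ℚ)) (*-nonNeg (nonNegative⁻¹ 2ℚ) (p≤q⇒0≤q-p 1≤ν))
    (solve 1 (λ v → con 3ℚ :* v := con 2ℚ :+ v :+ con 2ℚ :* (v :- con 1ℚ)) refl ν)
  -- The constant 51 is 3 times 17, the 3 coming from `2ℚ + ν ≤ 3ℚ * ν` for the number of blocks.
  size : (2ℚ + ν) * ℕ→ℚ k * (ε * ε) ≤ 51ℚ * (ν * ν)
  size = begin
    (2ℚ + ν) * ℕ→ℚ k * (ε * ε)    ≡⟨ *-assoc (2ℚ + ν) (ℕ→ℚ k) (ε * ε) ⟩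
    (2ℚ + ν) * (ℕ→ℚ k * (ε * ε))
      ≤⟨ *-mono (+-nonNeg (nonNegative⁻¹ 2ℚ) (<⇒≤ 0<ν)) (*-nonNeg (nonNegative⁻¹ 17ℚ) (<⇒≤ 0<ν)) 2+ν≤3ν kεε≤ ⟩
    3ℚ * ν * (17ℚ * ν)
      ≡⟨ solve 1 (λ v → con 3ℚ :* v :* (con 17ℚ :* v) := con 51ℚ :* (v :* v)) refl ν ⟩
    51ℚ * (ν * ν)                  ∎
    where open ≤-Reasoning

-- Importance weights and the sparsifier

module _ {n′ m′} (H : SubmodularHypergraph (suc n′) (suc m′)) (mono : AllMonotone H) where

  private
    n = suc n′
    m = suc m′
    ν = ℕ→ℚ n
    μ = inv ν

    1≤ν : 1ℚ ≤ ν
    1≤ν = 1≤ℕ→ℚ-suc n′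

    0<ν : 0ℚ < ν
    0<ν = <-≤-trans (positive⁻¹ 1ℚ) 1≤ν

    ν*μ≡1 : ν * μ ≡ 1ℚ
    ν*μ≡1 = *-inv (λ ν≡0 → <-irrefl (sym ν≡0) 0<ν)

    μ∈ : InUnit μ
    μ∈ = inv-nonNeg (<⇒≤ 0<ν) , subst₂ _≤_ (*-identityˡ μ) ν*μ≡1 (*-monoʳ μ (inv-nonNeg (<⇒≤ 0<ν)) 1≤ν)

    h : Fin m → Subset n → ℚ
    h = restricted H

    -- The ratio of `h e ⁅ v ⁆` to the cut of `⁅ v ⁆`. If that cut vanishes, the whole share goes to
    -- the first edge, which exists because `m` is a successor.
    vertexShare : Fin n → Fin m → ℚ
    vertexShare v = share (λ e → h e ⁅ v ⁆) (δ zero)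

    vertexShare-nonNeg : ∀ v e → 0ℚ ≤ vertexShare v e
    vertexShare-nonNeg v = share-nonNeg (λ e → restricted-nonNeg H e ⁅ v ⁆) (δ-nonNeg zero)

    w : Fin m → ℚ
    w e = Σℚ (λ v → vertexShare v e)

    w-nonNeg : ∀ e → 0ℚ ≤ w e
    w-nonNeg e = Σℚ-nonNeg (λ v → vertexShare-nonNeg v e)

    -- Exchanging the sums, each vertex hands out shares of total 1.
    Σw≡ν : Σℚ w ≡ ν
    Σw≡ν = begin
      Σℚ (λ e → Σℚ (λ v → vertexShare v e))  ≡⟨ Σℚ-swap (λ e v → vertexShare v e) ⟩
      Σℚ (λ v → Σℚ (vertexShare v))
        ≡⟨ Σℚ-cong (λ v → Σℚ-share (λ e → restricted-nonNeg H e ⁅ v ⁆) {δ zero} Σδ≡1) ⟩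
      Σℚ {n} (λ _ → 1ℚ)                      ≡⟨ Σℚ-const n 1ℚ ⟩
      ν * 1ℚ                                 ≡⟨ *-identityʳ ν ⟩
      ν                                      ∎
      where
      open ≡-Reasoning
      Σδ≡1 : Σℚ (δ {m} zero) ≡ 1ℚ
      Σδ≡1 = trans (cong (1ℚ +_) (Σℚ-zero {m′} (λ _ → refl))) (+-identityʳ 1ℚ)

    -- Monotonicity enters through `cut H ⁅ v ⁆ ≤ cut H S` for `v ∈ S`: it lets the share of `e` at
    -- `v`, scaled by the larger cut, dominate `h e ⁅ v ⁆`. Subadditivity then adds over the
    -- vertices.
    h≤cut*w : ∀ S e → h e S ≤ cut H S * w e
    h≤cut*w S e = ≤-trans
      (subadditive-bound (h e) (λ v → cut H S * vertexShare v e) (≤-reflexive (restricted-⊥ H e))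
        (restricted-subadditive H e) (λ v → *-nonNeg (cut-nonNeg H S) (vertexShare-nonNeg v e)) S single)
      (≤-reflexive (Σℚ-*ˡ (cut H S) (λ v → vertexShare v e)))
      where
      single : ∀ v → v ∈ S → h e ⁅ v ⁆ ≤ cut H S * vertexShare v e
      single v v∈S = subst (_≤ cut H S * vertexShare v e) (Σ*share (λ e → restricted-nonNeg H e ⁅ v ⁆) e)
        (*-monoʳ (vertexShare v e) (vertexShare-nonNeg v e)
          (Σℚ-mono (λ e → restricted-mono H mono e (λ x∈ → subst (_∈ S) (sym (x∈⁅y⁆⇒x≡y v x∈)) v∈S))))

    -- The default `w e * μ` is the drawing probability of `e`; it sums to 1 and is at most `w e`,
    -- the two properties required when the cut of `S` vanishes.
    cutShare : Subset n → Fin m → ℚ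
    cutShare S = share (λ e → h e S) (λ e → w e * μ)

    cutShare-nonNeg : ∀ S e → 0ℚ ≤ cutShare S e
    cutShare-nonNeg S = share-nonNeg (λ e → restricted-nonNeg H e S) (λ e → *-nonNeg (w-nonNeg e) (proj₁ μ∈))

    cutShare≤w : ∀ S e → cutShare S e ≤ w e
    cutShare≤w S e = share-≤ (λ e → restricted-nonNeg H e S)
      (≤-trans (*-monoˡ (w e) (w-nonNeg e) (proj₂ μ∈)) (≤-reflexive (*-identityʳ (w e)))) (h≤cut*w S e)

    y : Subset n → Fin m → ℚ
    y S e = cutShare S e * inv (w e)

    w*y≡cutShare : ∀ S e → w e * y S e ≡ cutShare S e
    w*y≡cutShare S e = p*[q*inv]≡q (cutShare-nonNeg S e) (cutShare≤w S e)

    y∈ : ∀ S e → InUnit (y S e)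
    y∈ S e = *-nonNeg (cutShare-nonNeg S e) (inv-nonNeg (w-nonNeg e))
           , ≤-trans (*-monoʳ (inv (w e)) (inv-nonNeg (w-nonNeg e)) (cutShare≤w S e)) (p*inv≤1 (w e))

    y-average : ∀ S → Σℚ (λ e → w e * y S e) ≡ 1ℚ
    y-average S = trans (Σℚ-cong (w*y≡cutShare S)) (Σℚ-share (λ e → restricted-nonNeg H e S)
      (trans (Σℚ-*ʳ w μ) (trans (cong (_* μ) Σw≡ν) ν*μ≡1)))

  sparsifier : ∀ {ε} → 0ℚ < ε → ε < 1ℚ → Sparsifies H 51ℚ ε
  sparsifier {ε} 0<ε ε<1 = support L , s , (s-pos , bounds) , size
    where
    -- The concentration bounds have relative error `8ℚ * d`, which must equal `ε`.
    d = ε * ⅛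
    8d≡ε : 8ℚ * d ≡ ε
    8d≡ε = solve 1 (λ e → con 8ℚ :* (e :* con ⅛) := e) refl ε
    tilt : IsTilt d
    tilt = subst (λ z → 0ℚ ≤ 1ℚ + z) (sym 8d≡ε) (+-nonNeg (nonNegative⁻¹ 1ℚ) (<⇒≤ 0<ε))
         , subst (λ z → 0ℚ ≤ 1ℚ - z) (sym 8d≡ε) (p≤q⇒0≤q-p (<⇒≤ ε<1))
    counted = sampleCount 1≤ν 0<ε ε<1
    k = proj₁ counted
    N = suc (suc n) ℕ.* k
    M = ℕ→ℚ N
    M≡ : M ≡ (2ℚ + ν) * ℕ→ℚ k
    M≡ = trans (ℕ→ℚ-* (suc (suc n)) k) (cong (_* ℕ→ℚ k) (ℕ→ℚ-+ 2 n))
    sampled = sampling μ∈ (trans (cong (μ *_) Σw≡ν) (trans (*-comm μ ν) ν*μ≡1)) y w-nonNeg y∈ y-average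
      (*-pos 0<ε (positive⁻¹ ⅛)) tilt k (proj₁ (proj₂ counted))
    L = proj₁ sampled
    k≢0 : ℕ→ℚ k ≢ 0ℚ
    k≢0 k≡0 = <-irrefl refl (<-≤-trans (positive⁻¹ 1ℚ) (≤-trans (proj₁ (proj₂ counted)) (≤-reflexive (*-annihˡ k≡0 _))))
    0<μM : 0ℚ < μ * M
    0<μM = *-pos (inv-pos 0<ν) (subst (0ℚ <_) (sym M≡)
      (*-pos (+-mono-< {0ℚ} {2ℚ} {0ℚ} (positive⁻¹ 2ℚ) 0<ν) (≢0⇒pos (ℕ→ℚ-nonNeg k) k≢0)))
    κ = inv (μ * M)
    0<κ : 0ℚ < κ
    0<κ = inv-pos 0<μM
    s : Fin m → ℚ
    -- `N` draws with probability `w e * μ` are expected to hit `e` exactly `μ * M * w e` times, so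
    -- the weight is the actual count over the expected one.
    s e = count L e * (κ * inv (w e))
    s-pos : ∀ e → e ∈ support L → 0ℚ < s e
    s-pos e e∈L = *-pos (∈-support⇒count-pos L e∈L) (*-pos 0<κ (inv-pos (All-support (proj₁ (proj₂ sampled)) e∈L)))
    -- Writing `h e S` as `cut H S * cutShare S e` makes every draw contribute
    -- `κ * cut H S * y S e`, also when the cut is 0.
    reweighted≡ : ∀ S → reweightedCut H (support L) s S ≡ κ * cut H S * sumOver (y S) L
    reweighted≡ S = begin
      reweightedCut H (support L) s S
        ≡⟨ reweightedCut-≡ H (support L) s (λ e e∉L → *-annihˡ (∉-support⇒count-zero L e∉L) (κ * inv (w e))) S ⟩
      Σℚ (λ e → count L e * (κ * inv (w e)) * h e S)
        ≡⟨ Σℚ-cong (λ e → *-assoc (count L e) (κ * inv (w e)) (h e S)) ⟩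
      Σℚ (λ e → count L e * (κ * inv (w e) * h e S))             ≡⟨ Σℚ-count L (λ e → κ * inv (w e) * h e S) ⟩
      sumOver (λ e → κ * inv (w e) * h e S) L                    ≡⟨ sumOver-cong L (λ e → trans
          (cong (κ * inv (w e) *_) (sym (Σ*share (λ e → restricted-nonNeg H e S) e)))
          (solve 4 (λ κ i c x → κ :* i :* (c :* x) := κ :* c :* (x :* i)) refl κ (inv (w e)) (cut H S) (cutShare S e))) ⟩
      sumOver (λ e → κ * cut H S * y S e) L                      ≡⟨ sumOver-*ˡ (κ * cut H S) (y S) L ⟩
      κ * cut H S * sumOver (y S) L                              ∎
      where open ≡-Reasoning
    0≤κ*cut : ∀ S → 0ℚ ≤ κ * cut H S
    0≤κ*cut S = *-nonNeg (<⇒≤ 0<κ) (cut-nonNeg H S)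
    rescale : ∀ c S → κ * cut H S * (c * (μ * M)) ≡ c * cut H S
    rescale c S = trans (solve 4 (λ κ x c t → κ :* x :* (c :* t) := c :* x :* (t :* κ)) refl κ (cut H S) c (μ * M))
      (trans (cong (c * cut H S *_) (*-inv (λ μM≡0 → <-irrefl (sym μM≡0) 0<μM))) (*-identityʳ (c * cut H S)))
    concentrated : ∀ S → (1ℚ - ε) * (μ * M) ≤ sumOver (y S) L × sumOver (y S) L ≤ (1ℚ + ε) * (μ * M)
    concentrated S = subst (λ z → (1ℚ - z) * (μ * M) ≤ sumOver (y S) L × sumOver (y S) L ≤ (1ℚ + z) * (μ * M)) 8d≡ε
      (proj₂ (proj₂ sampled) S)
    bounds : ∀ S → (1ℚ - ε) * cut H S ≤ reweightedCut H (support L) s S × reweightedCut H (support L) s S ≤ (1ℚ + ε) * cut H S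
    bounds S = subst₂ _≤_ (rescale (1ℚ - ε) S) (sym (reweighted≡ S)) (*-monoˡ (κ * cut H S) (0≤κ*cut S) (proj₁ (concentrated S)))
             , subst₂ _≤_ (sym (reweighted≡ S)) (rescale (1ℚ + ε) S) (*-monoˡ (κ * cut H S) (0≤κ*cut S) (proj₂ (concentrated S)))
    size : ℕ→ℚ ∣ support L ∣ * (ε * ε) ≤ 51ℚ * (ν * ν)
    size = ≤-trans (*-monoʳ (ε * ε) (square-nonNeg ε) (ℕ→ℚ-mono (∣support∣≤ L)))
      (subst (λ z → z * (ε * ε) ≤ 51ℚ * (ν * ν)) (sym M≡) (proj₂ (proj₂ counted)))

theorem7 : Σ ℚ λ C → (0ℚ < C) ×
    (∀ (n m : ℕ) (H : SubmodularHypergraph n m) → AllMonotone H →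
    ∀ (ε : ℚ) → 0ℚ < ε → ε < 1ℚ →
    Σ (Subset m) λ E' → Σ (Fin m → ℚ) λ s →
    IsReweightedSparsifier H ε E' s
    × (ℕ→ℚ ∣ E' ∣ * (ε * ε) ≤ C * (ℕ→ℚ n * ℕ→ℚ n)))
theorem7 = 51ℚ , positive⁻¹ 51ℚ , λ
  { zero    m       H mono ε 0<ε ε<1 → empty-sparsifier H ε (nonNegative⁻¹ 51ℚ) λ { [] → cut-⊥ H }
  ; (suc n) zero    H mono ε 0<ε ε<1 → empty-sparsifier H ε (nonNegative⁻¹ 51ℚ) λ _ → refl
  ; (suc n) (suc m) H mono ε 0<ε ε<1 → sparsifier H mono 0<ε ε<1
  }
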